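{- Let $n$ be even, let $G=G_{n,1/2}$ and let $Z_n$ be the number of unordered partitions of $V(G)$ into two sets $\{A,B\}$ such that $G[A]$ and $G[B]$ both have all degrees odd. Then for $0\le k\le n-1$, $$\Pr(Z_n=2^k)=\frac{2^{n-k-1}-1}{2^{\binom n2}(2^{n-1}-1)}\prod_{i=1}^{\lfloor (n-1-k)/2\rfloor}(1-2^{ -2i})^{ -1}\prod_{i=k+1}^{n-1}(2^i-1),$$ and $\Pr(Z_n=x)=0$ if $x\neq0$ and $x\neq 2^k$ for every $0\le k\le n-1$.
   Context: $G_{n,1/2}$ is the binomial random graph on vertex set $[n]$ with each edge present independently with probability $1/2$. Empty products equal $1$. -}

module Defs where

open import Data.Bool using (Bool; true; false; _∧_; not; if_then_else_)
open import Data.Nat as ℕ using (ℕ; zero; suc; _+_; _∸_; _≡ᵇ_)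
open import Data.Nat.Combinatorics using (_C_)
open import Data.Fin using (Fin; zero; suc)
open import Data.Vec using (Vec; []; _∷_; lookup)
open import Data.List using (List; []; _∷_; map; concatMap; foldr; length; filter; applyUpTo)
open import Data.Product using (_×_; _,_)
open import Data.Unit using (⊤; tt)
open import Data.Integer using (+_)
open import Data.Rational using (ℚ; _/_; _*_; 0ℚ; 1ℚ; 1/_; ≢-nonZero)
open import Data.Rational.Properties using (_≟_)
open import Relation.Nullary using (yes; no)

-- Simple graphs on vertex set Fin n, built vertex by vertex:
-- a graph on (suc n) vertices is a graph on the first n vertices together
-- with the adjacency vector of the last vertex to the earlier ones.
-- This is a bijective encoding of all labelled simple graphs on [n]
-- (one Bool per unordered pair {i,j}, i ≠ j).

Graph : ℕ → Set
Graph zero    = ⊤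
Graph (suc n) = Graph n × Vec Bool n

adj : ∀ {n} → Graph n → Fin n → Fin n → Bool
adj {suc n} (G , v) zero    zero    = false
adj {suc n} (G , v) zero    (suc j) = lookup v j
adj {suc n} (G , v) (suc i) zero    = lookup v i
adj {suc n} (G , v) (suc i) (suc j) = adj G i j
-- NB: vertex 'zero' of Fin (suc n) plays the role of the newly added vertex.

allVecs : (n : ℕ) → List (Vec Bool n)
allVecs zero    = [] ∷ []
allVecs (suc n) = concatMap (λ v → (false ∷ v) ∷ (true ∷ v) ∷ []) (allVecs n)

allGraphs : (n : ℕ) → List (Graph n)
allGraphs zero    = tt ∷ []
allGraphs (suc n) = concatMap (λ G → map (λ v → (G , v)) (allVecs n)) (allGraphs n)

allFin : (n : ℕ) → List (Fin n)
allFin zero    = []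
allFin (suc n) = zero ∷ map suc (allFin n)

count : ∀ {A : Set} → (A → Bool) → List A → ℕ
count p []       = 0
count p (x ∷ xs) = if p x then suc (count p xs) else count p xs

odd? : ℕ → Bool
odd? zero          = false
odd? (suc zero)    = true
odd? (suc (suc m)) = odd? m

all? : ∀ {A : Set} → (A → Bool) → List A → Bool
all? p xs = foldr (λ x b → p x ∧ b) true xs

Subset : ℕ → Set
Subset n = Vec Bool n

complement : ∀ {n} → Subset n → Subset n
complement []       = []
complement (b ∷ bs) = not b ∷ complement bs

degIn : ∀ {n} → Graph n → Subset n → Fin n → ℕ
degIn {n} G A v = count (λ u → lookup A u ∧ adj G v u) (allFin n)

-- G[A] has all degrees odd (vacuously true for A = ∅)
allOddIn : ∀ {n} → Graph n → Subset n → Bool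
allOddIn {n} G A = all? (λ v → if lookup A v then odd? (degIn G A v) else true) (allFin n)

-- Z_n(G): number of unordered partitions {A , B} of V(G) (B = V ∖ A, parts
-- may be empty) with G[A] and G[B] both having all degrees odd.
-- Each unordered partition corresponds to exactly two ordered ones (A, V∖A)
-- and (V∖A, A) when n ≥ 1, so Z = (number of such A) / 2.
Z : ∀ {n} → Graph n → ℕ
Z {n} G = ℕ._/_ (count (λ A → allOddIn G A ∧ allOddIn G (complement A)) (allVecs n)) 2

ℕtoℚ : ℕ → ℚ
ℕtoℚ m = + m / 1

-- multiplicative inverse, total (0⁻¹ := 0; only ever applied to nonzero values)
inv : ℚ → ℚ
inv p with p ≟ 0ℚ
... | yes _  = 0ℚ
... | no p≢0 = 1/_ p {{≢-nonZero p≢0}}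

-- ∏_{i=a}^{b} f i  (empty product = 1 when b < a)
prodFromTo : ℕ → ℕ → (ℕ → ℚ) → ℚ
prodFromTo a b f = foldr _*_ 1ℚ (applyUpTo (λ i → f (a + i)) (suc b ∸ a))

-- Probability, in G_{n,1/2}, that Z_n = x: every graph on [n] has
-- probability 2^{-(n choose 2)}.
ProbZ≡ : (n x : ℕ) → ℚ
ProbZ≡ n x = ℕtoℚ (count (λ G → Z G ≡ᵇ x) (allGraphs n)) * inv (ℕtoℚ (2 ℕ.^ (n C 2)))

{-# OPTIONS --safe #-}
module Submission where

-- Let m = n − 1 and let S be the Laplacian of G over 𝔽₂ with the row and column of one vertex
-- removed; S is uniformly distributed over all symmetric m × m matrices, diagonal included.
-- A set A avoiding that vertex gives an odd partition iff its indicator vector x satisfies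
-- S x = 𝟏 + diag S: the equation at the removed vertex is the sum of the others because n is even.
-- Hence Z is the number of solutions x.
--
-- For fixed c, consider S x = c + diag S over all S.  Since diag S represents the linear form
-- x ↦ xᵀ S x, this family of systems is stable under congruence, and eliminating the first row
-- (with a 1 × 1 or a hyperbolic 2 × 2 pivot) leaves a system of the same kind with S again uniform
-- over smaller symmetric matrices, and with c either still 𝟎 or again uniform.  So the distribution
-- of the number of solutions depends only on whether c = 𝟎, and the two resulting sequences satisfy
-- a recursion of order two that is solved in closed form.

open import Defs
open import Data.Bool using (Bool; T; true; false; _∧_; _xor_; not; if_then_else_)
open import Data.Bool.Properties using (T-∧; ∧-comm; ∧-idem; not-injective; not-involutive)
open import Data.Fin using (Fin; zero; suc)
open import Data.List as List using (List; []; _∷_; _++_; applyUpTo; concatMap; foldr)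
open import Data.Nat as ℕ using (ℕ; zero; suc; _+_; _∸_; _^_; _≤_; _<_; _/_; _≡ᵇ_; ⌊_/2⌋; z≤n; s≤s)
open import Data.Nat.Combinatorics using (_C_)
open import Data.Nat.Coprimality using (1-coprimeTo) renaming (sym to coprime-sym)
open import Data.Nat.Divisibility using (_∣_; divides)
open import Data.Nat.DivMod using (m/n≡1+[m∸n]/n; m*n/n≡m)
import Data.Nat.Properties as ℕ
open import Data.Nat.Solver using () renaming (module +-*-Solver to ℕS)
open import Data.Product using (_×_; _,_; ∃; proj₁; proj₂)
open import Data.Sum using (_⊎_; inj₁; inj₂; [_,_]′)
open import Data.Unit using (tt)
open import Data.Vec using (Vec; []; _∷_; head; lookup; map; replicate; tail; zipWith)
open import Data.Vec.Properties using (lookup-map; lookup-replicate; lookup-zipWith)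
open import Function using (_∘_; module Equivalence)
open import Relation.Binary.PropositionalEquality
open import Relation.Nullary using (yes; no; contradiction)

open Equivalence using (to)
open ≡-Reasoning

-- Linear systems over 𝔽₂ with a uniform symmetric matrix.

module SymmetricMatrices where

  open import Data.Nat using (_*_)
  open import Data.Nat.Properties using (*-identityˡ; *-zeroʳ; +-comm; +-identityʳ)
  open ℕS using (_:+_; _:*_; _:=_; con)

  private variable
    m k : ℕ

  -- A Boolean identity in n variables is encoded as a curried function returning its two sides, so
  -- that `taut` can prove it by evaluating `holds` on all 2ⁿ assignments. The underscore in each
  -- call stands for a proof of `T (holds n E)`, which reduces to the unit type.
  Equations : ℕ → Set
  Equations zero    = Bool × Bool
  Equations (suc n) = Bool → Equations n

  Valid : ∀ n → Equations n → Set
  Valid zero    (x , y) = x ≡ y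
  Valid (suc n) E       = ∀ x → Valid n (E x)

  holds : ∀ n → Equations n → Bool
  holds zero    (x , y) = not (x xor y)
  holds (suc n) E       = holds n (E false) ∧ holds n (E true)

  taut : ∀ n (E : Equations n) → T (holds n E) → Valid n E
  taut zero    (false , false) _ = refl
  taut zero    (true  , true)  _ = refl
  taut (suc n) E t false = taut n (E false) (proj₁ (T-∧ .to t))
  taut (suc n) E t true  = taut n (E true)  (proj₂ (T-∧ .to t))

  -- Vector arithmetic over 𝔽₂.

  infixl 6 _⊕_
  infixr 7 _⊙_

  _⊕_ : Vec Bool m → Vec Bool m → Vec Bool m
  _⊕_ = zipWith _xor_

  _⊙_ : Bool → Vec Bool m → Vec Bool m
  s ⊙ v = map (s ∧_) v

  𝟎 𝟏 : Vec Bool m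
  𝟎 = replicate _ false
  𝟏 = replicate _ true

  dot : Vec Bool m → Vec Bool m → Bool
  dot []      []      = false
  dot (x ∷ u) (y ∷ v) = (x ∧ y) xor dot u v

  isZero : Vec Bool m → Bool
  isZero []      = true
  isZero (x ∷ v) = not x ∧ isZero v

  ⊕-identityˡ : (u : Vec Bool m) → 𝟎 ⊕ u ≡ u
  ⊕-identityˡ []      = refl
  ⊕-identityˡ (x ∷ u) = cong (x ∷_) (⊕-identityˡ u)

  ⊙-zeroʳ : ∀ s → s ⊙ 𝟎 {m} ≡ 𝟎
  ⊙-zeroʳ {zero}  s = refl
  ⊙-zeroʳ {suc m} s = cong₂ _∷_ (taut 1 (λ s → s ∧ false , false) _ s) (⊙-zeroʳ s)

  ⊙-zeroˡ : (v : Vec Bool m) → false ⊙ v ≡ 𝟎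
  ⊙-zeroˡ []      = refl
  ⊙-zeroˡ (x ∷ v) = cong (false ∷_) (⊙-zeroˡ v)

  ⊙-identityˡ : (v : Vec Bool m) → true ⊙ v ≡ v
  ⊙-identityˡ []      = refl
  ⊙-identityˡ (x ∷ v) = cong (x ∷_) (⊙-identityˡ v)

  dot-comm : (u v : Vec Bool m) → dot u v ≡ dot v u
  dot-comm []      []      = refl
  dot-comm (x ∷ u) (y ∷ v) rewrite dot-comm u v =
    taut 3 (λ x y z → x ∧ y xor z , y ∧ x xor z) _ x y (dot v u)

  dot-⊕ : (u v w : Vec Bool m) → dot u (v ⊕ w) ≡ dot u v xor dot u w
  dot-⊕ []      []      []      = refl
  dot-⊕ (x ∷ u) (y ∷ v) (z ∷ w) rewrite dot-⊕ u v w =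
    taut 5 (λ x y z a b → x ∧ (y xor z) xor (a xor b) , (x ∧ y xor a) xor (x ∧ z xor b))
      _ x y z (dot u v) (dot u w)

  dot-⊙ : ∀ s (u v : Vec Bool m) → dot u (s ⊙ v) ≡ s ∧ dot u v
  dot-⊙ s []      []      = taut 1 (λ s → false , s ∧ false) _ s
  dot-⊙ s (x ∷ u) (y ∷ v) rewrite dot-⊙ s u v =
    taut 4 (λ s x y a → x ∧ (s ∧ y) xor s ∧ a , s ∧ (x ∧ y xor a)) _ s x y (dot u v)

  dot-zeroˡ : (u : Vec Bool m) → dot 𝟎 u ≡ false
  dot-zeroˡ []      = refl
  dot-zeroˡ (x ∷ u) = dot-zeroˡ u

  dot-zeroʳ : (u : Vec Bool m) → dot u 𝟎 ≡ false
  dot-zeroʳ u = trans (dot-comm u 𝟎) (dot-zeroˡ u)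

  isZero-𝟎 : ∀ m → isZero (𝟎 {m}) ≡ true
  isZero-𝟎 zero    = refl
  isZero-𝟎 (suc m) = isZero-𝟎 m

  isZero⇒≡𝟎 : (v : Vec Bool m) → isZero v ≡ true → v ≡ 𝟎
  isZero⇒≡𝟎 []          _  = refl
  isZero⇒≡𝟎 (false ∷ v) eq = cong (false ∷_) (isZero⇒≡𝟎 v eq)

  -- If `t` vanishes, so does `dot w t`; otherwise both sides are false. This absorbs the row
  -- operation that comes with a change of basis, and later the redundant equation at the removed
  -- vertex.
  isZero-shear : ∀ x (w t : Vec Bool m) → isZero (x ∷ t) ≡ isZero ((x xor dot w t) ∷ t)
  isZero-shear x w t with isZero t in eq
  ... | true  = cong (λ y → not y ∧ true)
    (sym (trans (cong (λ t → x xor dot w t) (isZero⇒≡𝟎 t eq))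
         (trans (cong (x xor_) (dot-zeroʳ w)) (taut 1 (λ x → x xor false , x) _ x))))
  ... | false = taut 2 (λ a b → a ∧ false , b ∧ false) _ (not x) (not (x xor dot w t))

  -- Nondegeneracy of the dot product; it supplies the vector along which `shear` changes the basis.
  dot-witness : (b : Vec Bool m) → isZero b ≡ false → ∃ λ w → dot b w ≡ true
  dot-witness (true ∷ b)  _  = true ∷ 𝟎 , cong not (dot-zeroʳ b)
  dot-witness (false ∷ b) nz with dot-witness b nz
  ... | w , eq = false ∷ w , eq

  -- e m = 2ᵐ − 1
  e : ℕ → ℕ
  e zero    = 0
  e (suc m) = suc (e m + e m)

  2^≡1+e : ∀ m → 2 ^ m ≡ suc (e m)
  2^≡1+e zero    = refl
  2^≡1+e (suc m) rewrite 2^≡1+e m =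
    ℕS.solve 1 (λ x → (con 2) :* (con 1 :+ x) := con 1 :+ (con 1 :+ (x :+ x))) refl (e m)

  -- Sums over all vectors.

  ΣV : ∀ m → (Vec Bool m → ℕ) → ℕ
  ΣV zero    f = f []
  ΣV (suc m) f = ΣV m (f ∘ (false ∷_)) + ΣV m (f ∘ (true ∷_))

  ΣV-cong : {f g : Vec Bool m → ℕ} → (∀ v → f v ≡ g v) → ΣV m f ≡ ΣV m g
  ΣV-cong {zero}  eq = eq []
  ΣV-cong {suc m} eq = cong₂ _+_ (ΣV-cong (eq ∘ (false ∷_))) (ΣV-cong (eq ∘ (true ∷_)))

  +-interchange : ∀ a b c d → (a + b) + (c + d) ≡ (a + c) + (b + d)
  +-interchange = ℕS.solve 4 (λ a b c d → (a :+ b) :+ (c :+ d) := (a :+ c) :+ (b :+ d)) refl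

  ΣV-+ : (f g : Vec Bool m → ℕ) → ΣV m (λ v → f v + g v) ≡ ΣV m f + ΣV m g
  ΣV-+ {zero}  f g = refl
  ΣV-+ {suc m} f g = trans
    (cong₂ _+_ (ΣV-+ (f ∘ (false ∷_)) (g ∘ (false ∷_))) (ΣV-+ (f ∘ (true ∷_)) (g ∘ (true ∷_))))
    (+-interchange (ΣV m (f ∘ (false ∷_))) (ΣV m (g ∘ (false ∷_))) (ΣV m (f ∘ (true ∷_))) (ΣV m (g ∘ (true ∷_))))

  ΣV-const : ∀ m x → ΣV m (λ _ → x) ≡ 2 ^ m * x
  ΣV-const zero    x = sym (*-identityˡ x)
  ΣV-const (suc m) x rewrite ΣV-const m x =
    ℕS.solve 2 (λ y x → y :* x :+ y :* x := (con 2 :* y) :* x) refl (2 ^ m) x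

  -- Translation permutes the vectors, so a uniform vector stays uniform after adding a fixed one.
  ΣV-shift : ∀ u (f : Vec Bool m → ℕ) → ΣV m (λ v → f (u ⊕ v)) ≡ ΣV m f
  ΣV-shift []          f = refl
  ΣV-shift (false ∷ u) f = cong₂ _+_ (ΣV-shift u (f ∘ (false ∷_))) (ΣV-shift u (f ∘ (true ∷_)))
  ΣV-shift (true ∷ u)  f = trans
    (cong₂ _+_ (ΣV-shift u (f ∘ (true ∷_))) (ΣV-shift u (f ∘ (false ∷_))))
    (+-comm (ΣV _ (f ∘ (true ∷_))) _)

  -- `e m` is the number of nonzero vectors.
  ΣV-nonzero : ∀ (f : Vec Bool m → ℕ) {x y} → f 𝟎 ≡ x → (∀ v → isZero v ≡ false → f v ≡ y) →
               ΣV m f ≡ x + e m * y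
  ΣV-nonzero {zero}  f {x} refl nz = sym (+-identityʳ x)
  ΣV-nonzero {suc m} f {x} {y} eq nz
    rewrite ΣV-nonzero (f ∘ (false ∷_)) eq (nz ∘ (false ∷_))
          | ΣV-cong {f = f ∘ (true ∷_)} {g = λ _ → y} (λ v → nz (true ∷ v) refl)
          | ΣV-const m y | 2^≡1+e m =
    ℕS.solve 3 (λ x y z → x :+ z :* y :+ (con 1 :+ z) :* y := x :+ (con 1 :+ (z :+ z)) :* y) refl x y (e m)


  -- Symmetric matrices and their quadratic forms.

  -- A symmetric matrix is stored as its upper triangle, one row per step.
  data Sym : ℕ → Set where
    []  : Sym zero
    _∷_ : Vec Bool (suc m) → Sym m → Sym (suc m)

  mul : Sym m → Vec Bool m → Vec Bool m
  mul []            []      = []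
  mul ((a ∷ b) ∷ S) (x ∷ v) = ((a ∧ x) xor dot b v) ∷ (x ⊙ b ⊕ mul S v)

  diag : Sym m → Vec Bool m
  diag []            = []
  diag ((a ∷ b) ∷ S) = a ∷ diag S

  mul-⊕ : ∀ S (u v : Vec Bool m) → mul S (u ⊕ v) ≡ mul S u ⊕ mul S v
  mul-⊕ []            []      []      = refl
  mul-⊕ ((a ∷ b) ∷ S) (x ∷ u) (y ∷ v) rewrite mul-⊕ S u v | dot-⊕ b u v = cong₂ _∷_
    (taut 5 (λ a x y p q → a ∧ (x xor y) xor (p xor q) , (a ∧ x xor p) xor (a ∧ y xor q))
       _ a x y (dot b u) (dot b v))
    (rearrange b (mul S u) (mul S v))
    where
    rearrange : ∀ {m} (b u v : Vec Bool m) → (x xor y) ⊙ b ⊕ (u ⊕ v) ≡ (x ⊙ b ⊕ u) ⊕ (y ⊙ b ⊕ v)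
    rearrange []      []      []      = refl
    rearrange (b ∷ bs) (u ∷ us) (v ∷ vs) = cong₂ _∷_
      (taut 5 (λ x y b u v → (x xor y) ∧ b xor (u xor v) , (x ∧ b xor u) xor (y ∧ b xor v))
         _ x y b u v)
      (rearrange bs us vs)

  mul-⊙ : ∀ s S (u : Vec Bool m) → mul S (s ⊙ u) ≡ s ⊙ mul S u
  mul-⊙ s []            []      = refl
  mul-⊙ s ((a ∷ b) ∷ S) (x ∷ u) rewrite mul-⊙ s S u | dot-⊙ s b u = cong₂ _∷_
    (taut 4 (λ s a x p → a ∧ (s ∧ x) xor s ∧ p , s ∧ (a ∧ x xor p)) _ s a x (dot b u))
    (rearrange b (mul S u))
    where
    rearrange : ∀ {m} (b u : Vec Bool m) → (s ∧ x) ⊙ b ⊕ s ⊙ u ≡ s ⊙ (x ⊙ b ⊕ u)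
    rearrange []       []       = refl
    rearrange (b ∷ bs) (u ∷ us) = cong₂ _∷_
      (taut 4 (λ s x b u → (s ∧ x) ∧ b xor s ∧ u , s ∧ (x ∧ b xor u)) _ s x b u)
      (rearrange bs us)

  mul-selfAdjoint : ∀ S (u v : Vec Bool m) → dot u (mul S v) ≡ dot (mul S u) v
  mul-selfAdjoint []            []      []      = refl
  mul-selfAdjoint ((a ∷ b) ∷ S) (x ∷ u) (y ∷ v)
    rewrite dot-⊕ u (y ⊙ b) (mul S v) | dot-⊙ y u b | dot-comm (x ⊙ b ⊕ mul S u) v
          | dot-⊕ v (x ⊙ b) (mul S u) | dot-⊙ x v b | mul-selfAdjoint S u v
          | dot-comm v (mul S u) | dot-comm v b | dot-comm u b =
    taut 6 (λ a x y p q r →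
      x ∧ (a ∧ y xor p) xor (y ∧ q xor r) , (a ∧ x xor q) ∧ y xor (x ∧ p xor r))
      _ a x y (dot b v) (dot b u) (dot (mul S u) v)

  -- Over 𝔽₂ each off-diagonal term of wᵀ S w occurs twice and cancels, while squares equal their
  -- base. Hence `diag S` represents a linear form that transforms together with `S` under
  -- congruence.
  mul-quadratic : ∀ S (w : Vec Bool m) → dot w (mul S w) ≡ dot w (diag S)
  mul-quadratic []            []      = refl
  mul-quadratic ((a ∷ b) ∷ S) (x ∷ w)
    rewrite dot-⊕ w (x ⊙ b) (mul S w) | dot-⊙ x w b | dot-comm w b | mul-quadratic S w =
    taut 4 (λ a x p r → x ∧ (a ∧ x xor p) xor (x ∧ p xor r) , x ∧ a xor r)
      _ a x (dot b w) (dot w (diag S))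

  -- Sums over all symmetric matrices and rank-one updates.

  ΣS : ∀ m → (Sym m → ℕ) → ℕ
  ΣS zero    f = f []
  ΣS (suc m) f = ΣV (suc m) (λ r → ΣS m (λ S → f (r ∷ S)))

  ΣS-cong : {f g : Sym m → ℕ} → (∀ S → f S ≡ g S) → ΣS m f ≡ ΣS m g
  ΣS-cong {zero}  eq = eq []
  ΣS-cong {suc m} eq = ΣV-cong (λ r → ΣS-cong (λ S → eq (r ∷ S)))

  ΣS-+ : (f g : Sym m → ℕ) → ΣS m (λ S → f S + g S) ≡ ΣS m f + ΣS m g
  ΣS-+ {zero}  f g = refl
  ΣS-+ {suc m} f g = trans
    (ΣV-cong (λ r → ΣS-+ (λ S → f (r ∷ S)) (λ S → g (r ∷ S))))
    (ΣV-+ (λ r → ΣS m (λ S → f (r ∷ S))) (λ r → ΣS m (λ S → g (r ∷ S))))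

  ΣS-ΣV-comm : ∀ k (f : Sym m → Vec Bool k → ℕ) →
               ΣS m (λ S → ΣV k (f S)) ≡ ΣV k (λ v → ΣS m (λ S → f S v))
  ΣS-ΣV-comm zero    f = refl
  ΣS-ΣV-comm (suc k) f = trans (ΣS-+ (λ S → ΣV k (f S ∘ (false ∷_))) (λ S → ΣV k (f S ∘ (true ∷_))))
    (cong₂ _+_ (ΣS-ΣV-comm k (λ S → f S ∘ (false ∷_))) (ΣS-ΣV-comm k (λ S → f S ∘ (true ∷_))))

  ΣS-zero : ∀ m → ΣS m (λ _ → 0) ≡ 0
  ΣS-zero zero    = refl
  ΣS-zero (suc m) = trans (ΣV-cong {suc m} {g = λ _ → 0} (λ _ → ΣS-zero m))
    (trans (ΣV-const (suc m) 0) (*-zeroʳ (2 ^ suc m)))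

  -- S + v vᵀ
  addSquare : Vec Bool m → Sym m → Sym m
  addSquare []      []      = []
  addSquare (x ∷ v) (r ∷ S) = (x ⊙ (x ∷ v) ⊕ r) ∷ addSquare v S

  -- Each stored row is translated by a vector that depends on `v` alone.
  ΣS-addSquare : ∀ v (f : Sym m → ℕ) → ΣS m (f ∘ addSquare v) ≡ ΣS m f
  ΣS-addSquare []      f = refl
  ΣS-addSquare (x ∷ v) f = trans
    (ΣV-cong (λ r → ΣS-addSquare v (λ S → f ((x ⊙ (x ∷ v) ⊕ r) ∷ S))))
    (ΣV-shift (x ⊙ (x ∷ v)) (λ r → ΣS _ (λ S → f (r ∷ S))))

  diag-addSquare : ∀ v (S : Sym m) → diag (addSquare v S) ≡ v ⊕ diag S
  diag-addSquare []      []            = refl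
  diag-addSquare (x ∷ v) ((a ∷ b) ∷ S) = cong₂ _∷_ (cong (_xor a) (∧-idem x)) (diag-addSquare v S)

  mul-addSquare : ∀ v (S : Sym m) u → mul (addSquare v S) u ≡ dot v u ⊙ v ⊕ mul S u
  mul-addSquare []      []            []      = refl
  mul-addSquare (x ∷ v) ((a ∷ b) ∷ S) (y ∷ u)
    rewrite mul-addSquare v S u | dot-comm (x ⊙ v ⊕ b) u | dot-⊕ u (x ⊙ v) b | dot-⊙ x u v
          | dot-comm u v | dot-comm u b | ∧-idem x = cong₂ _∷_
    (taut 5 (λ x a y p q →
       (x xor a) ∧ y xor (x ∧ p xor q) , (x ∧ y xor p) ∧ x xor (a ∧ y xor q))
       _ x a y (dot v u) (dot b u))
    (rearrange (dot v u) v b (mul S u))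
    where
    rearrange : ∀ {m} d (v b u : Vec Bool m) →
      y ⊙ (x ⊙ v ⊕ b) ⊕ (d ⊙ v ⊕ u) ≡ ((x ∧ y) xor d) ⊙ v ⊕ (y ⊙ b ⊕ u)
    rearrange d []       []       []       = refl
    rearrange d (v ∷ vs) (b ∷ bs) (u ∷ us) = cong₂ _∷_
      (taut 6 (λ x y d v b u → y ∧ (x ∧ v xor b) xor (d ∧ v xor u) , (x ∧ y xor d) ∧ v xor (y ∧ b xor u))
         _ x y d v b u)
      (rearrange d vs bs us)

  -- Counting solutions and eliminating rows.

  ind : Bool → ℕ
  ind b = if b then 1 else 0

  -- Subtraction is addition here, so this vanishes exactly when S x = c + diag S.
  residual : Sym m → Vec Bool m → Vec Bool m → Vec Bool m
  residual S c x = mul S x ⊕ (c ⊕ diag S)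

  solutions : Sym m → Vec Bool m → ℕ
  solutions {m} S c = ΣV m (λ x → ind (isZero (residual S c x)))

  ⊕-assoc : (u v w : Vec Bool m) → (u ⊕ v) ⊕ w ≡ u ⊕ (v ⊕ w)
  ⊕-assoc []      []      []      = refl
  ⊕-assoc (x ∷ u) (y ∷ v) (z ∷ w) =
    cong₂ _∷_ (taut 3 (λ x y z → (x xor y) xor z , x xor (y xor z)) _ x y z) (⊕-assoc u v w)

  ΣV-head : (f : Vec Bool (suc m) → ℕ) → ΣV (suc m) f ≡ ΣV m (λ v → f (false ∷ v) + f (true ∷ v))
  ΣV-head f = sym (ΣV-+ (f ∘ (false ∷_)) (f ∘ (true ∷_)))

  ΣV-head₂ : (f : Vec Bool (suc (suc m)) → ℕ) → ΣV (suc (suc m)) f ≡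
    ΣV m (λ v → (f (false ∷ false ∷ v) + f (false ∷ true ∷ v)) + (f (true ∷ false ∷ v) + f (true ∷ true ∷ v)))
  ΣV-head₂ f = trans (cong₂ _+_ (ΣV-head (f ∘ (false ∷_))) (ΣV-head (f ∘ (true ∷_))))
    (sym (ΣV-+ (λ v → f (false ∷ false ∷ v) + f (false ∷ true ∷ v)) (λ v → f (true ∷ false ∷ v) + f (true ∷ true ∷ v))))

  -- An equation in which x has coefficient 1 fixes x, so only the summand at x = s survives.
  pivot : ∀ s (h g : Bool → Bool) → (∀ x → h x ≡ x xor s) →
          ind (not (h false) ∧ g false) + ind (not (h true) ∧ g true) ≡ ind (g s)
  pivot s h g eq rewrite eq false | eq true with s
  ... | false = +-identityʳ (ind (g false))
  ... | true  = refl

  -- The first equation gives x₀ = b · x + c₁ + 1. Substituting it into the others adds b bᵀ to the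
  -- matrix, c₁ b to `c`, and a further b; the latter is exactly the change of the diagonal caused
  -- by b bᵀ, so the system keeps its shape.
  solutions-pivot₁ : ∀ b (S : Sym m) c₁ c →
    solutions ((true ∷ b) ∷ S) (c₁ ∷ c) ≡ solutions (addSquare b S) (c ⊕ c₁ ⊙ b)
  solutions-pivot₁ b S c₁ c = trans (ΣV-head (ind ∘ isZero ∘ residual ((true ∷ b) ∷ S) (c₁ ∷ c))) (ΣV-cong λ x →
    trans (pivot (dot b x xor not c₁) (λ x₀ → (x₀ xor dot b x) xor (c₁ xor true))
                   (λ x₀ → isZero ((x₀ ⊙ b ⊕ mul S x) ⊕ (c ⊕ diag S)))
            (λ x₀ → taut 3 (λ x₀ d c₁ → (x₀ xor d) xor (c₁ xor true) , x₀ xor (d xor (true xor c₁)))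
                      _ x₀ (dot b x) c₁))
          (cong (ind ∘ isZero) (trans (rearrange (dot b x) b (mul S x) c (diag S))
            (cong₂ (λ u v → u ⊕ ((c ⊕ c₁ ⊙ b) ⊕ v)) (sym (mul-addSquare b S x)) (sym (diag-addSquare b S))))))
    where
    rearrange : ∀ {m} β (b u c d : Vec Bool m) →
      ((β xor not c₁) ⊙ b ⊕ u) ⊕ (c ⊕ d) ≡ (β ⊙ b ⊕ u) ⊕ ((c ⊕ c₁ ⊙ b) ⊕ (b ⊕ d))
    rearrange β []       []       []       []       = refl
    rearrange β (b ∷ bs) (u ∷ us) (c ∷ cs) (d ∷ ds) = cong₂ _∷_
      (taut 6 (λ β c₁ b u c d → ((β xor (true xor c₁)) ∧ b xor u) xor (c xor d)
                    , (β ∧ b xor u) xor ((c xor c₁ ∧ b) xor (b xor d))) _ β c₁ b u c d)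
      (rearrange β bs us cs ds)

  -- With a zero first row x₀ is free, which doubles the count, and the first equation reads 0 = c₁:
  -- void here, contradictory in the next lemma.
  solutions-false∷𝟎 : ∀ (S : Sym m) c → solutions ((false ∷ 𝟎) ∷ S) (false ∷ c) ≡ solutions S c + solutions S c
  solutions-false∷𝟎 {m} S c = cong₂ _+_ (ΣV-cong (eq false)) (ΣV-cong (eq true))
    where
    eq : ∀ x₀ x → ind (isZero (residual ((false ∷ 𝟎) ∷ S) (false ∷ c) (x₀ ∷ x))) ≡ ind (isZero (residual S c x))
    eq x₀ x rewrite dot-zeroˡ x | ⊙-zeroʳ {m} x₀ | ⊕-identityˡ (mul S x) = refl

  solutions-false∷𝟎-inconsistent : ∀ (S : Sym m) c → solutions ((false ∷ 𝟎) ∷ S) (true ∷ c) ≡ 0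
  solutions-false∷𝟎-inconsistent {m} S c = trans
    (cong₂ _+_ (ΣV-cong (eq false)) (ΣV-cong (eq true)))
    (trans (cong₂ _+_ (ΣV-const m 0) (ΣV-const m 0)) (ℕS.solve 1 (λ x → x :* con 0 :+ x :* con 0 := con 0) refl (2 ^ m)))
    where
    eq : ∀ x₀ x → ind (isZero (residual ((false ∷ 𝟎) ∷ S) (true ∷ c) (x₀ ∷ x))) ≡ 0
    eq x₀ x rewrite dot-zeroˡ x = refl

  -- T + p b bᵀ + b qᵀ + q bᵀ
  schur : Bool → Vec Bool m → Vec Bool m → Sym m → Sym m
  schur p b q T = addSquare (b ⊕ q) (addSquare (not p ⊙ b) (addSquare q T))

  -- Elimination of the invertible block with rows (0, 1) and (1, p). The Schur complement is
  -- written as `T` plus the three squares of b + q, (1 + p) b and q, so that `ΣS-addSquare` applies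
  -- to each of them.
  solutions-pivot₂ : ∀ b p q (T : Sym m) c₁ c₂ c →
    solutions ((false ∷ true ∷ b) ∷ (p ∷ q) ∷ T) (c₁ ∷ c₂ ∷ c)
      ≡ solutions (schur p b q T) ((c ⊕ c₂ ⊙ b) ⊕ c₁ ⊙ (p ⊙ b ⊕ q))
  solutions-pivot₂ b p q T c₁ c₂ c = trans
    (ΣV-head₂ (ind ∘ isZero ∘ residual ((false ∷ true ∷ b) ∷ (p ∷ q) ∷ T) (c₁ ∷ c₂ ∷ c))) (ΣV-cong λ y →
    let β = dot b y ; γ = dot q y
        h₀ = λ x₁ → (x₁ xor β) xor (c₁ xor false)
        h₁ = λ x₁ x₀ → ((x₀ ∧ true) xor ((p ∧ x₁) xor γ)) xor (c₂ xor p)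
        z  = λ x₀ x₁ → isZero ((x₀ ⊙ b ⊕ (x₁ ⊙ q ⊕ mul T y)) ⊕ (c ⊕ diag T))
        -- The first equation contains x₁ but not x₀ and forces x₁ = `s₁`; the second then forces x₀
        -- = `s₀`.
        s₁ = β xor c₁
        s₀ = ((p ∧ s₁) xor γ) xor (c₂ xor p)
        step = λ x₀ → pivot s₁ h₀ (λ x₁ → not (h₁ x₁ x₀) ∧ z x₀ x₁)
          (λ x₁ → taut 3 (λ x β c₁ → (x xor β) xor (c₁ xor false) , x xor (β xor c₁)) _ x₁ β c₁)
    in trans (cong₂ _+_ (step false) (step true))
       (trans (pivot s₀ (h₁ s₁) (λ x₀ → z x₀ s₁)
         (λ x₀ → taut 5 (λ x p s γ c → (x ∧ true xor (p ∧ s xor γ)) xor c , x xor ((p ∧ s xor γ) xor c))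
                   _ x₀ p s₁ γ (c₂ xor p)))
       (cong (ind ∘ isZero) (trans (rearrange p β γ b q (mul T y) c (diag T))
         (cong₂ (λ u v → u ⊕ (((c ⊕ c₂ ⊙ b) ⊕ c₁ ⊙ (p ⊙ b ⊕ q)) ⊕ v)) (mul-schur y) diag-schur)))))
    where
    dot-lin : ∀ y → dot (b ⊕ q) y ≡ dot b y xor dot q y
    dot-lin y rewrite dot-comm (b ⊕ q) y | dot-⊕ y b q | dot-comm y b | dot-comm y q = refl
    dot-scal : ∀ y → dot (not p ⊙ b) y ≡ not p ∧ dot b y
    dot-scal y rewrite dot-comm (not p ⊙ b) y | dot-⊙ (not p) y b | dot-comm y b = refl
    mul-schur : ∀ y → (dot b y xor dot q y) ⊙ (b ⊕ q) ⊕ ((not p ∧ dot b y) ⊙ (not p ⊙ b) ⊕ (dot q y ⊙ q ⊕ mul T y))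
                      ≡ mul (schur p b q T) y
    mul-schur y rewrite mul-addSquare (b ⊕ q) (addSquare (not p ⊙ b) (addSquare q T)) y
      | mul-addSquare (not p ⊙ b) (addSquare q T) y | mul-addSquare q T y | dot-lin y | dot-scal y = refl
    diag-schur : (b ⊕ q) ⊕ (not p ⊙ b ⊕ (q ⊕ diag T)) ≡ diag (schur p b q T)
    diag-schur rewrite diag-addSquare (b ⊕ q) (addSquare (not p ⊙ b) (addSquare q T))
      | diag-addSquare (not p ⊙ b) (addSquare q T) | diag-addSquare q T = refl
    rearrange : ∀ {m} p β γ (b q u c d : Vec Bool m) →
      ((((p ∧ (β xor c₁)) xor γ) xor (c₂ xor p)) ⊙ b ⊕ ((β xor c₁) ⊙ q ⊕ u)) ⊕ (c ⊕ d)
      ≡ ((β xor γ) ⊙ (b ⊕ q) ⊕ ((not p ∧ β) ⊙ (not p ⊙ b) ⊕ (γ ⊙ q ⊕ u)))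
        ⊕ (((c ⊕ c₂ ⊙ b) ⊕ c₁ ⊙ (p ⊙ b ⊕ q)) ⊕ ((b ⊕ q) ⊕ (not p ⊙ b ⊕ (q ⊕ d))))
    rearrange p     β γ []       []       []       []       []       = refl
    rearrange p β γ (b ∷ bs) (q ∷ qs) (u ∷ us) (c ∷ cs) (d ∷ ds) = cong₂ _∷_
      (taut 10 (λ p β γ c₁ c₂ b q u c d →
        ((((p ∧ (β xor c₁)) xor γ) xor (c₂ xor p)) ∧ b xor ((β xor c₁) ∧ q xor u)) xor (c xor d)
        , ((β xor γ) ∧ (b xor q) xor ((not p ∧ β) ∧ (not p ∧ b) xor (γ ∧ q xor u)))
        xor (((c xor c₂ ∧ b) xor c₁ ∧ (p ∧ b xor q)) xor ((b xor q) xor (not p ∧ b xor (q xor d)))))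
        _ p β γ c₁ c₂ b q u c d)
      (rearrange p β γ bs qs us cs ds)

  -- Congruence by shears.

  -- The change of basis e₀ ↦ e₀ + w, with w supported on the remaining coordinates.
  shear : Vec Bool m → Sym m → Vec Bool (suc m)
  shear w T = dot w (diag T) ∷ mul T w

  -- If P is the matrix of the change of basis, the new matrix is Pᵀ S P and the new residual is Pᵀ
  -- applied to the old one. The corner entry gains 2 (q · w) + wᵀ T w, which is w · diag T by
  -- `mul-quadratic`; hence `diag S`, like `c`, is transformed by Pᵀ.
  residual-shear : ∀ w r (T : Sym m) c₁ c x y →
    let t = residual (r ∷ T) (c₁ ∷ c) (x ∷ (x ⊙ w ⊕ y)) in
    residual ((shear w T ⊕ r) ∷ T) ((c₁ xor dot w c) ∷ c) (x ∷ y)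
      ≡ (head t xor dot w (tail t)) ∷ tail t
  residual-shear w (p ∷ q) T c₁ c x y
    rewrite mul-⊕ T (x ⊙ w) y | mul-⊙ x T w
    = cong₂ _∷_ hd (rearrange (mul T w) q (mul T y) (c ⊕ diag T))
    where
    rearrange : ∀ {m} (s q u d : Vec Bool m) → (x ⊙ (s ⊕ q) ⊕ u) ⊕ d ≡ (x ⊙ q ⊕ (x ⊙ s ⊕ u)) ⊕ d
    rearrange []       []       []       []       = refl
    rearrange (s ∷ ss) (q ∷ qs) (u ∷ us) (d ∷ ds) = cong₂ _∷_
      (taut 5 (λ x s q u d → (x ∧ (s xor q) xor u) xor d , (x ∧ q xor (x ∧ s xor u)) xor d) _ x s q u d)
      (rearrange ss qs us ds)
    hd : (((dot w (diag T) xor p) ∧ x) xor dot (mul T w ⊕ q) y) xor ((c₁ xor dot w c) xor (dot w (diag T) xor p))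
       ≡ (((p ∧ x) xor dot q (x ⊙ w ⊕ y)) xor (c₁ xor p)) xor
         dot w ((x ⊙ q ⊕ (x ⊙ mul T w ⊕ mul T y)) ⊕ (c ⊕ diag T))
    hd rewrite dot-comm (mul T w ⊕ q) y | dot-⊕ y (mul T w) q | dot-comm y (mul T w) | dot-comm y q
       | dot-⊕ q (x ⊙ w) y | dot-⊙ x q w
       | dot-⊕ w (x ⊙ q ⊕ (x ⊙ mul T w ⊕ mul T y)) (c ⊕ diag T) | dot-⊕ w c (diag T)
       | dot-⊕ w (x ⊙ q) (x ⊙ mul T w ⊕ mul T y) | dot-⊕ w (x ⊙ mul T w) (mul T y)
       | dot-⊙ x w q | dot-⊙ x w (mul T w) | mul-quadratic T w | mul-selfAdjoint T w y | dot-comm w q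
       = taut 8 (λ p x c₁ D c s γ ω →
           (((D xor p) ∧ x) xor (s xor γ)) xor ((c₁ xor c) xor (D xor p))
           , (((p ∧ x) xor (x ∧ ω xor γ)) xor (c₁ xor p)) xor ((x ∧ ω xor (x ∧ D xor s)) xor (c xor D)))
           _ p x c₁ (dot w (diag T)) (dot w c) (dot (mul T w) y) (dot q y) (dot q w)

  -- The substitution y ↦ x w + y is a bijection for each x, and the row operation preserves
  -- vanishing.
  solutions-shear : ∀ w r (T : Sym m) c₁ c →
    solutions ((shear w T ⊕ r) ∷ T) ((c₁ xor dot w c) ∷ c) ≡ solutions (r ∷ T) (c₁ ∷ c)
  solutions-shear w r@(_ ∷ _) T c₁ c = cong₂ _+_ (eq false) (eq true)
    where
    eq : ∀ x → ΣV _ (λ y → ind (isZero (residual ((shear w T ⊕ r) ∷ T) ((c₁ xor dot w c) ∷ c) (x ∷ y))))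
             ≡ ΣV _ (λ y → ind (isZero (residual (r ∷ T) (c₁ ∷ c) (x ∷ y))))
    isZero-shear′ : ∀ t → isZero ((head t xor dot w (tail t)) ∷ tail t) ≡ isZero t
    isZero-shear′ (h ∷ t) = sym (isZero-shear h w t)
    eq x = trans
      (ΣV-cong λ y → trans (cong (ind ∘ isZero) (residual-shear w r T c₁ c x y))
                           (cong ind (isZero-shear′ (residual (r ∷ T) (c₁ ∷ c) (x ∷ (x ⊙ w ⊕ y))))))
      (ΣV-shift (x ⊙ w) (λ y → ind (isZero (residual (r ∷ T) (c₁ ∷ c) (x ∷ y)))))

  -- The shear acts on the block below the first row and turns that row from (0, 0, b) into (0, b ·
  -- w, b). This moves a nonzero entry next to the corner, where `solutions-pivot₂` needs it.
  solutions-shear₂ : ∀ b w → dot b w ≡ true → ∀ r (T : Sym m) c₀ c₁ c →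
    solutions ((false ∷ true ∷ b) ∷ (shear w T ⊕ r) ∷ T) (c₀ ∷ (c₁ xor dot w c) ∷ c)
      ≡ solutions ((false ∷ false ∷ b) ∷ r ∷ T) (c₀ ∷ c₁ ∷ c)
  solutions-shear₂ b w bw r@(_ ∷ _) T c₀ c₁ c =
    cong₂ _+_ (cong₂ _+_ (eq false false) (eq false true)) (cong₂ _+_ (eq true false) (eq true true))
    where
    S′ = (shear w T ⊕ r) ∷ T
    eq : ∀ x₀ x₁ →
      ΣV _ (λ y → ind (isZero (residual ((false ∷ true ∷ b) ∷ S′) (c₀ ∷ (c₁ xor dot w c) ∷ c) (x₀ ∷ x₁ ∷ y)))) ≡
      ΣV _ (λ y → ind (isZero (residual ((false ∷ false ∷ b) ∷ r ∷ T) (c₀ ∷ c₁ ∷ c) (x₀ ∷ x₁ ∷ y))))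
    eq x₀ x₁ = trans (ΣV-cong λ y → cong ind (pointwise y))
      (ΣV-shift (x₁ ⊙ w) (λ y → ind (isZero (residual ((false ∷ false ∷ b) ∷ r ∷ T) (c₀ ∷ c₁ ∷ c) (x₀ ∷ x₁ ∷ y)))))
      where
      pointwise : ∀ y → isZero (residual ((false ∷ true ∷ b) ∷ S′) (c₀ ∷ (c₁ xor dot w c) ∷ c) (x₀ ∷ x₁ ∷ y))
                      ≡ isZero (residual ((false ∷ false ∷ b) ∷ r ∷ T) (c₀ ∷ c₁ ∷ c) (x₀ ∷ x₁ ∷ (x₁ ⊙ w ⊕ y)))
      pointwise y = cong₂ (λ u v → not u ∧ v) hd
        (trans (cong isZero (⊕-assoc (x₀ ⊙ (true ∷ b)) (mul S′ (x₁ ∷ y)) (((c₁ xor dot w c) ∷ c) ⊕ diag S′)))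
        (trans (cong (λ z → isZero (x₀ ⊙ (true ∷ b) ⊕ z)) (residual-shear w r T c₁ c x₁ y))
        (trans (combine (residual (r ∷ T) (c₁ ∷ c) (x₁ ∷ (x₁ ⊙ w ⊕ y))))
        (cong isZero (sym (⊕-assoc (x₀ ⊙ (false ∷ b)) (mul (r ∷ T) (x₁ ∷ (x₁ ⊙ w ⊕ y))) ((c₁ ∷ c) ⊕ diag (r ∷ T))))))))
        where
        hd : (x₁ xor dot b y) xor (c₀ xor false) ≡ dot b (x₁ ⊙ w ⊕ y) xor (c₀ xor false)
        hd rewrite dot-⊕ b (x₁ ⊙ w) y | dot-⊙ x₁ b w | bw =
          taut 3 (λ x β c → (x xor β) xor (c xor false) , (x ∧ true xor β) xor (c xor false))
            _ x₁ (dot b y) c₀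
        -- Adding x₀ b to the tail changes its product with `w` by x₀, since b · w = 1; this
        -- accounts for the new entry 1 beside the corner.
        combine : ∀ R → isZero (x₀ ⊙ (true ∷ b) ⊕ ((head R xor dot w (tail R)) ∷ tail R))
                      ≡ isZero (x₀ ⊙ (false ∷ b) ⊕ R)
        combine (h ∷ t) = trans (cong (λ z → isZero (z ∷ (x₀ ⊙ b ⊕ t))) hd′) (sym (isZero-shear _ w (x₀ ⊙ b ⊕ t)))
          where
          hd′ : (x₀ ∧ true) xor (h xor dot w t) ≡ ((x₀ ∧ false) xor h) xor dot w (x₀ ⊙ b ⊕ t)
          hd′ rewrite dot-⊕ w (x₀ ⊙ b) t | dot-⊙ x₀ w b | dot-comm w b | bw =
            taut 3 (λ x h d → x ∧ true xor (h xor d) , (x ∧ false xor h) xor (x ∧ true xor d))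
              _ x₀ h (dot w t)

  -- The recursion for the distribution of the number of solutions.

  -- For h 0 = 0, F m c h depends on c only through whether c = 𝟎: it is A m h if so, B m h if not.
  F : ∀ m → Vec Bool m → (ℕ → ℕ) → ℕ
  F m c h = ΣS m (λ S → h (solutions S c))

  -- The summands of the recursion come from the first row of S: zero, false ∷ b with b ≠ 𝟎
  -- (a 2 × 2 pivot), and true ∷ b (a 1 × 1 pivot).  In B a zero row makes the system inconsistent.
  A : ℕ → (ℕ → ℕ) → ℕ
  A zero          h = h 1
  A (suc zero)    h = h 2 + h 1
  A (suc (suc m)) h = (A (suc m) (λ x → h (x + x)) + e (suc m) * (2 * (2 ^ m * A m h))) + 2 ^ suc m * A (suc m) h

  B : ℕ → (ℕ → ℕ) → ℕ
  B zero          h = 0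
  B (suc zero)    h = h 1
  B (suc (suc m)) h = e (suc m) * (2 * (A m h + e m * B m h)) + (A (suc m) h + e (suc m) * B (suc m) h)

  ΣS-pivot₁ : ∀ h b c₁ (c : Vec Bool m) →
    ΣS m (λ S → h (solutions ((true ∷ b) ∷ S) (c₁ ∷ c))) ≡ F m (c ⊕ c₁ ⊙ b) h
  ΣS-pivot₁ h b c₁ c = trans (ΣS-cong λ S → cong h (solutions-pivot₁ b S c₁ c))
    (ΣS-addSquare b (λ S → h (solutions S (c ⊕ c₁ ⊙ b))))

  ΣS-pivot₂ : ∀ h b p q c₁ c₂ (c : Vec Bool m) →
    ΣS m (λ T → h (solutions ((false ∷ true ∷ b) ∷ (p ∷ q) ∷ T) (c₁ ∷ c₂ ∷ c)))
      ≡ F m ((c ⊕ c₂ ⊙ b) ⊕ c₁ ⊙ (p ⊙ b ⊕ q)) h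
  ΣS-pivot₂ h b p q c₁ c₂ c = trans (ΣS-cong λ T → cong h (solutions-pivot₂ b p q T c₁ c₂ c))
    (trans (ΣS-addSquare q (λ T → f (addSquare (b ⊕ q) (addSquare (not p ⊙ b) T))))
    (trans (ΣS-addSquare (not p ⊙ b) (λ T → f (addSquare (b ⊕ q) T)))
           (ΣS-addSquare (b ⊕ q) f)))
    where f = λ T → h (solutions T ((c ⊕ c₂ ⊙ b) ⊕ c₁ ⊙ (p ⊙ b ⊕ q)))

  -- The translation of the first row depends on `T`, so the sum over that row is moved inside: for
  -- each fixed `T` it is a plain translation.
  ΣS-shear : ∀ w (g f : Sym (suc m) → ℕ) → (∀ r T → f ((shear w T ⊕ r) ∷ T) ≡ g (r ∷ T)) →
             ΣS (suc m) g ≡ ΣS (suc m) f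
  ΣS-shear {m} w g f eq = trans (sym (ΣS-ΣV-comm (suc m) (λ T r → g (r ∷ T))))
    (trans (ΣS-cong λ T → trans (ΣV-cong {suc m} λ r → sym (eq r T))
                                (ΣV-shift (shear w T) (λ r → f (r ∷ T))))
           (ΣS-ΣV-comm (suc m) (λ T r → f (r ∷ T))))

  -- A shear along some `w` with w · c = 1 flips the first coordinate of the right-hand side.
  F-false≡F-true : ∀ h (c : Vec Bool m) → isZero c ≡ false → F (suc m) (false ∷ c) h ≡ F (suc m) (true ∷ c) h
  F-false≡F-true h c nz with dot-witness c nz
  ... | w , cw = ΣS-shear w (λ S → h (solutions S (false ∷ c))) (λ S → h (solutions S (true ∷ c))) λ r T → cong h (trans
    (cong (λ s → solutions ((shear w T ⊕ r) ∷ T) (s ∷ c)) (sym (trans (dot-comm w c) cw)))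
    (solutions-shear w r T false c))

  -- The condition `h 0 ≡ 0` makes inconsistent systems contribute nothing.
  Spec : ℕ → Set
  Spec m = ∀ h → h 0 ≡ 0 → (F m 𝟎 h ≡ A m h) × (∀ c → isZero c ≡ false → F m c h ≡ B m h)

  ΣV-F : Spec m → ∀ h → h 0 ≡ 0 → ∀ u → ΣV m (λ v → F m (u ⊕ v) h) ≡ A m h + e m * B m h
  ΣV-F {m} spec h h0 u = trans (ΣV-shift u (λ v → F m v h))
    (ΣV-nonzero (λ v → F m v h) (proj₁ (spec h h0)) (proj₂ (spec h h0)))

  module Step {m} (spec₀ : Spec m) (spec₁ : Spec (suc m)) (h : ℕ → ℕ) (h0 : h 0 ≡ 0) where

    -- When c = 𝟎 the pivot leaves 𝟎, so all 2 · 2ᵐ choices of the second row `p ∷ q` contribute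
    -- equally. A row whose `b` starts with 0 is first sheared into one starting with 1.
    hyperbolic-𝟎 : ∀ b → isZero b ≡ false →
      ΣS (suc m) (λ S → h (solutions ((false ∷ b) ∷ S) 𝟎)) ≡ 2 * (2 ^ m * A m h)
    hyperbolic-𝟎 (true ∷ b) _ = trans (cong₂ _+_ (half false) (half true))
      (ℕS.solve 1 (λ x → x :+ x := con 2 :* x) refl (2 ^ m * A m h))
      where
      c-𝟎 : ∀ p q → (𝟎 ⊕ false ⊙ b) ⊕ false ⊙ (p ⊙ b ⊕ q) ≡ 𝟎
      c-𝟎 p q rewrite ⊙-zeroˡ b | ⊙-zeroˡ (p ⊙ b ⊕ q) | ⊕-identityˡ (𝟎 {m}) = ⊕-identityˡ 𝟎
      half : ∀ p → ΣV m (λ q → ΣS m (λ T → h (solutions ((false ∷ true ∷ b) ∷ (p ∷ q) ∷ T) 𝟎))) ≡ 2 ^ m * A m h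
      half p = trans (ΣV-cong λ q → trans (ΣS-pivot₂ h b p q false false 𝟎)
                       (trans (cong (λ c → F m c h) (c-𝟎 p q)) (proj₁ (spec₀ h h0))))
                     (ΣV-const m (A m h))
    hyperbolic-𝟎 (false ∷ b) nz with dot-witness b nz
    ... | w , bw = trans
      (ΣS-shear w (λ S → h (solutions ((false ∷ false ∷ b) ∷ S) 𝟎)) (λ S → h (solutions ((false ∷ true ∷ b) ∷ S) 𝟎))
        λ r T → cong h (trans
        (cong (λ s → solutions ((false ∷ true ∷ b) ∷ (shear w T ⊕ r) ∷ T) (false ∷ s ∷ 𝟎)) (sym (dot-zeroʳ w)))
        (solutions-shear₂ b w bw r T false false 𝟎)))
      (hyperbolic-𝟎 (true ∷ b) refl)

    -- Since c₁ = 1, the reduced right-hand side contains `q` as a summand and is uniform as `q`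
    -- varies.
    hyperbolic-true : ∀ b → isZero b ≡ false → ∀ c₂ c →
      ΣS (suc m) (λ S → h (solutions ((false ∷ b) ∷ S) (true ∷ c₂ ∷ c))) ≡ 2 * (A m h + e m * B m h)
    hyperbolic-true (true ∷ b) _ c₂ c = trans (cong₂ _+_ (half false) (half true))
      (ℕS.solve 1 (λ x → x :+ x := con 2 :* x) refl (A m h + e m * B m h))
      where
      half : ∀ p → ΣV m (λ q → ΣS m (λ T → h (solutions ((false ∷ true ∷ b) ∷ (p ∷ q) ∷ T) (true ∷ c₂ ∷ c))))
                 ≡ A m h + e m * B m h
      half p = trans (ΣV-cong λ q → trans (ΣS-pivot₂ h b p q true c₂ c)
                       (cong (λ v → F m ((c ⊕ c₂ ⊙ b) ⊕ v) h) (⊙-identityˡ (p ⊙ b ⊕ q))))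
               (trans (ΣV-shift (p ⊙ b) (λ q → F m ((c ⊕ c₂ ⊙ b) ⊕ q) h))
                      (ΣV-F spec₀ h h0 (c ⊕ c₂ ⊙ b)))
    hyperbolic-true (false ∷ b) nz c₂ c with dot-witness b nz
    ... | w , bw = trans
      (ΣS-shear w (λ S → h (solutions ((false ∷ false ∷ b) ∷ S) (true ∷ c₂ ∷ c)))
         (λ S → h (solutions ((false ∷ true ∷ b) ∷ S) (true ∷ (c₂ xor dot w c) ∷ c)))
         λ r T → cong h (solutions-shear₂ b w bw r T true c₂ c))
      (hyperbolic-true (true ∷ b) refl (c₂ xor dot w c) c)

    F-𝟎 : F (suc (suc m)) 𝟎 h ≡ A (suc (suc m)) h
    F-𝟎 = cong₂ _+_
      (ΣV-nonzero (λ b → ΣS (suc m) (λ S → h (solutions ((false ∷ b) ∷ S) 𝟎)))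
        (trans (ΣS-cong {suc m} λ S → cong h (solutions-false∷𝟎 S 𝟎)) (proj₁ (spec₁ (λ x → h (x + x)) h0)))
        hyperbolic-𝟎)
      (trans (ΣV-cong {suc m} λ b → trans (ΣS-pivot₁ h b false 𝟎)
                (trans (cong (λ c → F (suc m) c h) (trans (cong (𝟎 ⊕_) (⊙-zeroˡ b)) (⊕-identityˡ 𝟎)))
                       (proj₁ (spec₁ h h0))))
             (ΣV-const (suc m) (A (suc m) h)))

    -- Since c₁ = 1, a 1 × 1 pivot replaces the right-hand side `c₂ ∷ c` by its sum with `b`, which
    -- is uniform as `b` varies.
    F-true : ∀ c → F (suc (suc m)) (true ∷ c) h ≡ B (suc (suc m)) h
    F-true (c₂ ∷ c) = cong₂ _+_
      (ΣV-nonzero (λ b → ΣS (suc m) (λ S → h (solutions ((false ∷ b) ∷ S) (true ∷ c₂ ∷ c))))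
        (trans (ΣS-cong {suc m} λ S → trans (cong h (solutions-false∷𝟎-inconsistent S (c₂ ∷ c))) h0) (ΣS-zero (suc m)))
        (λ b nz → hyperbolic-true b nz c₂ c))
      (trans (ΣV-cong {suc m} λ b → trans (ΣS-pivot₁ h b true (c₂ ∷ c))
                (cong (λ v → F (suc m) ((c₂ ∷ c) ⊕ v) h) (⊙-identityˡ b)))
             (ΣV-F spec₁ h h0 (c₂ ∷ c)))

  -- Two consecutive sizes are carried along because a 2 × 2 pivot lowers the size by two.
  F-spec : ∀ m → Spec m × Spec (suc m)
  F-spec zero = (λ h h0 → refl , λ { [] () }) , (λ h h0 → refl , λ { (true ∷ []) _ → cong (_+ h 1) h0 })
  F-spec (suc m) with F-spec m
  ... | spec₀ , spec₁ = spec₁ , λ h h0 → F-𝟎 h h0 , λ { (true ∷ c) _ → F-true h h0 c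
                                                     ; (false ∷ c) nz → trans (F-false≡F-true h c nz) (F-true h h0 c) }
    where open Step spec₀ spec₁

open SymmetricMatrices

-- Odd partitions of a graph as solutions of a linear system.

module OddPartitions where

  open import Data.Nat using (_*_)
  open import Data.Nat.Properties using (+-assoc; +-identityʳ)
  open ℕS using (_:+_; _:*_; _:=_; con)

  private variable
    n : ℕ
    X Y : Set

  -- Counts over lists as sums over vectors and graphs.

  ΣL : (X → ℕ) → List X → ℕ
  ΣL f []       = 0
  ΣL f (x ∷ xs) = f x + ΣL f xs

  count≡ΣL : ∀ p (xs : List X) → count p xs ≡ ΣL (ind ∘ p) xs
  count≡ΣL p []       = refl
  count≡ΣL p (x ∷ xs) with p x
  ... | true  = cong suc (count≡ΣL p xs)
  ... | false = count≡ΣL p xs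

  ΣL-++ : ∀ f (xs ys : List X) → ΣL f (xs ++ ys) ≡ ΣL f xs + ΣL f ys
  ΣL-++ f []       ys = refl
  ΣL-++ f (x ∷ xs) ys = trans (cong (f x +_) (ΣL-++ f xs ys)) (sym (+-assoc (f x) (ΣL f xs) (ΣL f ys)))

  ΣL-concatMap : ∀ f (g : X → List Y) xs → ΣL f (concatMap g xs) ≡ ΣL (λ x → ΣL f (g x)) xs
  ΣL-concatMap f g []       = refl
  ΣL-concatMap f g (x ∷ xs) = trans (ΣL-++ f (g x) (concatMap g xs)) (cong (ΣL f (g x) +_) (ΣL-concatMap f g xs))

  ΣL-map : ∀ f (g : X → Y) xs → ΣL f (List.map g xs) ≡ ΣL (f ∘ g) xs
  ΣL-map f g []       = refl
  ΣL-map f g (x ∷ xs) = cong (f (g x) +_) (ΣL-map f g xs)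

  ΣL-allVecs : ∀ n f → ΣL f (allVecs n) ≡ ΣV n f
  ΣL-allVecs zero    f = +-identityʳ (f [])
  ΣL-allVecs (suc n) f = begin
    ΣL f (allVecs (suc n))                                     ≡⟨ ΣL-concatMap f _ (allVecs n) ⟩
    ΣL (λ v → f (false ∷ v) + (f (true ∷ v) + 0)) (allVecs n)  ≡⟨ ΣL-allVecs n _ ⟩
    ΣV n (λ v → f (false ∷ v) + (f (true ∷ v) + 0))            ≡⟨ ΣV-cong (λ v → cong (f (false ∷ v) +_) (+-identityʳ _)) ⟩
    ΣV n (λ v → f (false ∷ v) + f (true ∷ v))                  ≡⟨ ΣV-+ (f ∘ (false ∷_)) (f ∘ (true ∷_)) ⟩
    ΣV (suc n) f                                               ∎

  ΣG : ∀ n → (Graph n → ℕ) → ℕ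
  ΣG zero    f = f tt
  ΣG (suc n) f = ΣG n (λ G → ΣV n (λ v → f (G , v)))

  ΣG-cong : ∀ n {f g : Graph n → ℕ} → (∀ G → f G ≡ g G) → ΣG n f ≡ ΣG n g
  ΣG-cong zero    eq = eq tt
  ΣG-cong (suc n) eq = ΣG-cong n (λ G → ΣV-cong (λ v → eq (G , v)))

  ΣG-+ : ∀ n (f g : Graph n → ℕ) → ΣG n (λ G → f G + g G) ≡ ΣG n f + ΣG n g
  ΣG-+ zero    f g = refl
  ΣG-+ (suc n) f g = trans (ΣG-cong n (λ G → ΣV-+ (λ v → f (G , v)) (λ v → g (G , v))))
    (ΣG-+ n (λ G → ΣV n (λ v → f (G , v))) (λ G → ΣV n (λ v → g (G , v))))

  ΣG-ΣV-comm : ∀ n k (f : Graph n → Vec Bool k → ℕ) →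
               ΣG n (λ G → ΣV k (f G)) ≡ ΣV k (λ v → ΣG n (λ G → f G v))
  ΣG-ΣV-comm n zero    f = refl
  ΣG-ΣV-comm n (suc k) f = trans
    (ΣG-+ n (λ G → ΣV k (f G ∘ (false ∷_))) (λ G → ΣV k (f G ∘ (true ∷_))))
    (cong₂ _+_ (ΣG-ΣV-comm n k (λ G → f G ∘ (false ∷_))) (ΣG-ΣV-comm n k (λ G → f G ∘ (true ∷_))))

  ΣL-allGraphs : ∀ n f → ΣL f (allGraphs n) ≡ ΣG n f
  ΣL-allGraphs zero    f = +-identityʳ (f tt)
  ΣL-allGraphs (suc n) f = trans (ΣL-concatMap f _ (allGraphs n)) (trans (ΣL-allGraphs n _)
    (ΣG-cong n λ G → trans (ΣL-map f (λ v → (G , v)) (allVecs n)) (ΣL-allVecs n _)))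

  -- The adjacency matrix over 𝔽₂ and degree parities.

  adjMul : Graph n → Vec Bool n → Vec Bool n
  adjMul {zero}  _       []      = []
  adjMul {suc n} (G , b) (x ∷ v) = dot b v ∷ (x ⊙ b ⊕ adjMul G v)

  adjMul-⊕ : ∀ (G : Graph n) u v → adjMul G (u ⊕ v) ≡ adjMul G u ⊕ adjMul G v
  adjMul-⊕ {zero}  _       []      []      = refl
  adjMul-⊕ {suc n} (G , b) (x ∷ u) (y ∷ v) rewrite adjMul-⊕ G u v =
    cong₂ _∷_ (dot-⊕ b u v) (rearrange b (adjMul G u) (adjMul G v))
    where
    rearrange : ∀ {n} (b u v : Vec Bool n) → (x xor y) ⊙ b ⊕ (u ⊕ v) ≡ (x ⊙ b ⊕ u) ⊕ (y ⊙ b ⊕ v)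
    rearrange []       []       []       = refl
    rearrange (b ∷ bs) (u ∷ us) (v ∷ vs) = cong₂ _∷_
      (taut 5 (λ x y b u v → (x xor y) ∧ b xor (u xor v) , (x ∧ b xor u) xor (y ∧ b xor v)) _ x y b u v)
      (rearrange bs us vs)

  odd?-suc : ∀ k → odd? (suc k) ≡ not (odd? k)
  odd?-suc zero          = refl
  odd?-suc (suc zero)    = refl
  odd?-suc (suc (suc k)) = odd?-suc k

  odd?-count-∷ : ∀ p x (xs : List X) → odd? (count p (x ∷ xs)) ≡ p x xor odd? (count p xs)
  odd?-count-∷ p x xs with p x
  ... | true  = odd?-suc (count p xs)
  ... | false = refl

  count-map : ∀ p (f : X → Y) xs → count p (List.map f xs) ≡ count (p ∘ f) xs
  count-map p f []       = refl
  count-map p f (x ∷ xs) rewrite count-map p f xs = refl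

  odd?-count-allFin : ∀ (p : Fin (suc n) → Bool) →
    odd? (count p (allFin (suc n))) ≡ p zero xor odd? (count (p ∘ suc) (allFin n))
  odd?-count-allFin {n} p = trans (odd?-count-∷ p zero (List.map suc (allFin n)))
    (cong (λ k → p zero xor odd? k) (count-map p suc (allFin n)))

  odd?-common : ∀ (b A : Vec Bool n) → odd? (count (λ j → lookup A j ∧ lookup b j) (allFin n)) ≡ dot b A
  odd?-common []      []      = refl
  odd?-common (x ∷ b) (a ∷ A) = trans (odd?-count-allFin (λ j → lookup (a ∷ A) j ∧ lookup (x ∷ b) j))
    (cong₂ _xor_ (∧-comm a x) (odd?-common b A))

  odd?-degIn : ∀ (G : Graph n) A v → odd? (degIn G A v) ≡ lookup (adjMul G A) v
  odd?-degIn {suc n} (G , b) (a ∷ A) zero = trans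
    (odd?-count-allFin (λ u → lookup (a ∷ A) u ∧ adj {suc n} (G , b) zero u))
    (cong₂ _xor_ (taut 1 (λ a → a ∧ false , false) _ a) (odd?-common b A))
  odd?-degIn {suc n} (G , b) (a ∷ A) (suc v) = trans
    (odd?-count-allFin (λ u → lookup (a ∷ A) u ∧ adj {suc n} (G , b) (suc v) u))
    (trans (cong ((a ∧ lookup b v) xor_) (odd?-degIn G A v))
    (sym (trans (lookup-zipWith _xor_ v (a ⊙ b) (adjMul G A))
                (cong (_xor lookup (adjMul G A) v) (lookup-map v (a ∧_) b)))))

  all?-map : ∀ p (f : X → Y) xs → all? p (List.map f xs) ≡ all? (p ∘ f) xs
  all?-map p f []       = refl
  all?-map p f (x ∷ xs) = cong (p (f x) ∧_) (all?-map p f xs)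

  all?-∧ : ∀ p q (xs : List X) → all? p xs ∧ all? q xs ≡ all? (λ x → p x ∧ q x) xs
  all?-∧ p q []       = refl
  all?-∧ p q (x ∷ xs) = trans
    (taut 4 (λ a b c d → (a ∧ b) ∧ (c ∧ d) , (a ∧ c) ∧ (b ∧ d)) _ (p x) (all? p xs) (q x) (all? q xs))
    (cong ((p x ∧ q x) ∧_) (all?-∧ p q xs))

  all?-isZero : ∀ (p : Fin n → Bool) v → (∀ i → p i ≡ not (lookup v i)) → all? p (allFin n) ≡ isZero v
  all?-isZero p []      eq = refl
  all?-isZero {suc n} p (x ∷ v) eq = cong₂ _∧_ (eq zero)
    (trans (all?-map p suc (allFin n)) (all?-isZero (p ∘ suc) v (eq ∘ suc)))

  complement≡𝟏⊕ : ∀ (A : Vec Bool n) → complement A ≡ 𝟏 ⊕ A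
  complement≡𝟏⊕ []      = refl
  complement≡𝟏⊕ (x ∷ A) = cong (not x ∷_) (complement≡𝟏⊕ A)

  complement-involutive : ∀ (A : Vec Bool n) → complement (complement A) ≡ A
  complement-involutive []      = refl
  complement-involutive (x ∷ A) = cong₂ _∷_ (not-involutive x) (complement-involutive A)

  lookup-complement : ∀ (A : Vec Bool n) i → lookup (complement A) i ≡ not (lookup A i)
  lookup-complement (x ∷ A) zero    = refl
  lookup-complement (x ∷ A) (suc i) = lookup-complement A i

  oddPartition : Graph n → Subset n → Bool
  oddPartition G A = allOddIn G A ∧ allOddIn G (complement A)

  oddPartition-complement : ∀ (G : Graph n) A → oddPartition G (complement A) ≡ oddPartition G A
  oddPartition-complement G A = trans
    (cong (λ A′ → allOddIn G (complement A) ∧ allOddIn G A′) (complement-involutive A))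
    (∧-comm (allOddIn G (complement A)) (allOddIn G A))

  -- Let M be the adjacency matrix and x the indicator of `A`. Coordinate i vanishes iff vertex i
  -- has odd degree in its own part: (M x)ᵢ = 1 if i lies in `A`, and (M 𝟏)ᵢ + (M x)ᵢ = 1 otherwise.
  defect : Graph n → Subset n → Vec Bool n
  defect G A = adjMul G A ⊕ (𝟏 ⊕ zipWith _∧_ (𝟏 ⊕ A) (adjMul G 𝟏))

  oddPartition≡ : ∀ (G : Graph n) A → oddPartition G A ≡ isZero (defect G A)
  oddPartition≡ {n} G A = trans (all?-∧ _ _ (allFin n)) (all?-isZero _ (defect G A) eq)
    where
    eq : ∀ i → (if lookup A i then odd? (degIn G A i) else true)
             ∧ (if lookup (complement A) i then odd? (degIn G (complement A) i) else true)
             ≡ not (lookup (defect G A) i)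
    eq i rewrite odd?-degIn G A i | odd?-degIn G (complement A) i | lookup-complement A i | complement≡𝟏⊕ A
      | adjMul-⊕ G 𝟏 A | lookup-zipWith _xor_ i (adjMul G 𝟏) (adjMul G A)
      | lookup-zipWith _xor_ i (adjMul G A) (𝟏 ⊕ zipWith _∧_ (𝟏 ⊕ A) (adjMul G 𝟏))
      | lookup-zipWith _xor_ i 𝟏 (zipWith _∧_ (𝟏 ⊕ A) (adjMul G 𝟏))
      | lookup-zipWith _∧_ i (𝟏 ⊕ A) (adjMul G 𝟏)
      | lookup-zipWith _xor_ i 𝟏 A | lookup-replicate i true
      = taut 3 (λ a y z → (if a then y else true) ∧ (if not a then z xor y else true) , not (y xor not (not a ∧ z)))
          _ (lookup A i) (lookup (adjMul G A) i) (lookup (adjMul G 𝟏) i)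

  -- The reduced Laplacian.

  toSym : Graph n → Vec Bool n → Sym n
  toSym {zero}  _       []      = []
  toSym {suc n} (G , b) (a ∷ d) = (a ∷ b) ∷ toSym G d

  diag-toSym : ∀ (G : Graph n) d → diag (toSym G d) ≡ d
  diag-toSym {zero}  _       []      = refl
  diag-toSym {suc n} (G , b) (a ∷ d) = cong (a ∷_) (diag-toSym G d)

  mul-toSym : ∀ (G : Graph n) d x → mul (toSym G d) x ≡ adjMul G x ⊕ zipWith _∧_ d x
  mul-toSym {zero}  _       []      []      = refl
  mul-toSym {suc n} (G , b) (a ∷ d) (x ∷ v) rewrite mul-toSym G d v = cong₂ _∷_
    (taut 2 (λ a b → a xor b , b xor a) _ (a ∧ x) (dot b v))
    (sym (⊕-assoc (x ⊙ b) (adjMul G v) (zipWith _∧_ d v)))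

  -- A graph together with an arbitrary diagonal is the same data as a symmetric matrix; the proof
  -- only reorders the sums.
  ΣG-toSym : ∀ n (f : Sym n → ℕ) → ΣG n (λ G → ΣV n (λ d → f (toSym G d))) ≡ ΣS n f
  ΣG-toSym zero    f = refl
  ΣG-toSym (suc n) f = trans (ΣG-cong n λ G → ΣV-+ (λ b → ΣV n (λ d → f ((false ∷ b) ∷ toSym G d)))
                                                   (λ b → ΣV n (λ d → f ((true ∷ b) ∷ toSym G d))))
    (trans (ΣG-+ n (λ G → ΣV n (λ b → ΣV n (λ d → f ((false ∷ b) ∷ toSym G d))))
                   (λ G → ΣV n (λ b → ΣV n (λ d → f ((true ∷ b) ∷ toSym G d)))))
           (cong₂ _+_ (half false) (half true)))
    where
    half : ∀ a → ΣG n (λ G → ΣV n (λ b → ΣV n (λ d → f ((a ∷ b) ∷ toSym G d))))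
               ≡ ΣV n (λ b → ΣS n (λ S → f ((a ∷ b) ∷ S)))
    half a = trans (ΣG-ΣV-comm n n (λ G b → ΣV n (λ d → f ((a ∷ b) ∷ toSym G d))))
      (ΣV-cong λ b → ΣG-toSym n (λ S → f ((a ∷ b) ∷ S)))

  zipWith-∧-𝟏 : ∀ (d : Vec Bool n) → zipWith _∧_ d 𝟏 ≡ d
  zipWith-∧-𝟏 []      = refl
  zipWith-∧-𝟏 (x ∷ d) = cong₂ _∷_ (taut 1 (λ x → x ∧ true , x) _ x) (zipWith-∧-𝟏 d)

  dot-𝟏-𝟏 : ∀ n → dot (𝟏 {n}) 𝟏 ≡ odd? n
  dot-𝟏-𝟏 zero    = refl
  dot-𝟏-𝟏 (suc n) = trans (cong not (dot-𝟏-𝟏 n)) (sym (odd?-suc n))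

  -- Each edge is counted from both ends: the row and the column of the new vertex cancel.
  handshake : ∀ (G : Graph n) → dot 𝟏 (adjMul G 𝟏) ≡ false
  handshake {zero}  _       = refl
  handshake {suc n} (G , b) rewrite dot-⊕ 𝟏 (true ⊙ b) (adjMul G 𝟏) | handshake G
    | ⊙-identityˡ b | dot-comm 𝟏 b = taut 1 (λ x → x xor (x xor false) , false) _ (dot b 𝟏)

  -- The removed vertex is the newest one, with neighbours `b`; the diagonal holds the degree
  -- parities of the remaining vertices in the whole graph.
  laplacian : Graph (suc n) → Sym n
  laplacian (G , b) = toSym G (adjMul G 𝟏 ⊕ b)

  -- The rows of the full Laplacian sum to zero, so those of the reduced one sum to the deleted
  -- column.
  mul-laplacian-𝟏 : ∀ (G : Graph n) b → mul (laplacian (G , b)) 𝟏 ≡ b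
  mul-laplacian-𝟏 G b rewrite mul-toSym G (adjMul G 𝟏 ⊕ b) 𝟏 | zipWith-∧-𝟏 (adjMul G 𝟏 ⊕ b) =
    cancel (adjMul G 𝟏) b
    where
    cancel : ∀ {n} (u v : Vec Bool n) → u ⊕ (u ⊕ v) ≡ v
    cancel []      []      = refl
    cancel (x ∷ u) (y ∷ v) = cong₂ _∷_ (taut 2 (λ x y → x xor (x xor y) , y) _ x y) (cancel u v)

  -- The equation at vertex 0 is the sum of the others since the number of vertices is even.
  oddPartition-false : odd? n ≡ true → ∀ (G : Graph n) b x →
    oddPartition {suc n} (G , b) (false ∷ x) ≡ isZero (residual (laplacian (G , b)) 𝟏 x)
  oddPartition-false {n} odd G b x = begin
    oddPartition {suc n} (G , b) (false ∷ x)  ≡⟨ oddPartition≡ {suc n} (G , b) (false ∷ x) ⟩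
    isZero (defect {suc n} (G , b) (false ∷ x)) ≡⟨ cong₂ (λ h t → isZero (h ∷ t)) hd tl ⟩
    isZero (dot 𝟏 t ∷ t)                      ≡⟨ sym (isZero-shear false 𝟏 t) ⟩
    isZero t                                  ∎
    where
    S = laplacian (G , b)
    d = adjMul G 𝟏 ⊕ b
    t = residual S 𝟏 x
    -- Here 𝟏 · S x = S 𝟏 · x = b · x by self-adjointness, 𝟏 · 𝟏 = 1 because n is odd, and 𝟏 · diag
    -- S = 𝟏 · b by `handshake`.
    hd : dot b x xor not (dot b 𝟏) ≡ dot 𝟏 t
    hd rewrite dot-⊕ 𝟏 (mul S x) (𝟏 ⊕ diag S) | mul-selfAdjoint S 𝟏 x | mul-laplacian-𝟏 G b
      | dot-⊕ 𝟏 𝟏 (diag S) | dot-𝟏-𝟏 n | odd | diag-toSym G d | dot-⊕ 𝟏 (adjMul G 𝟏) b | handshake G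
      | dot-comm 𝟏 b = refl
    rearrange : ∀ {n} (u a x b : Vec Bool n) →
      (false ⊙ b ⊕ u) ⊕ (𝟏 ⊕ zipWith _∧_ (𝟏 ⊕ x) (true ⊙ b ⊕ a)) ≡ (u ⊕ zipWith _∧_ (a ⊕ b) x) ⊕ (𝟏 ⊕ (a ⊕ b))
    rearrange []       []       []       []       = refl
    rearrange (u ∷ us) (a ∷ as) (x ∷ xs) (b ∷ bs) = cong₂ _∷_
      (taut 4 (λ u a x b → u xor not (not x ∧ (b xor a)) , (u xor (a xor b) ∧ x) xor not (a xor b)) _ u a x b)
      (rearrange us as xs bs)
    tl : (false ⊙ b ⊕ adjMul G x) ⊕ (𝟏 ⊕ zipWith _∧_ (𝟏 ⊕ x) (true ⊙ b ⊕ adjMul G 𝟏)) ≡ t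
    tl rewrite mul-toSym G d x | diag-toSym G d = rearrange (adjMul G x) (adjMul G 𝟏) x b

  Z≡solutions : odd? n ≡ true → ∀ (G : Graph (suc n)) → Z {suc n} G ≡ solutions (laplacian G) 𝟏
  Z≡solutions {n} odd (G , b) = trans (cong (_/ 2) eq) (m*n/n≡m N 2)
    where
    N = solutions (laplacian (G , b)) 𝟏
    P = oddPartition {suc n} (G , b)
    falseHalf : ΣV n (λ x → ind (P (false ∷ x))) ≡ N
    falseHalf = ΣV-cong λ x → cong ind (oddPartition-false odd G b x)
    -- Complementation exchanges the sets containing the removed vertex with those avoiding it.
    trueHalf : ΣV n (λ x → ind (P (true ∷ x))) ≡ N
    trueHalf = begin
      ΣV n (λ x → ind (P (true ∷ x)))
        ≡⟨ ΣV-cong (λ x → cong ind (sym (oddPartition-complement {suc n} (G , b) (true ∷ x)))) ⟩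
      ΣV n (λ x → ind (P (false ∷ complement x)))  ≡⟨ ΣV-cong (λ x → cong (λ y → ind (P (false ∷ y))) (complement≡𝟏⊕ x)) ⟩
      ΣV n (λ x → ind (P (false ∷ (𝟏 ⊕ x))))       ≡⟨ ΣV-shift 𝟏 (λ x → ind (P (false ∷ x))) ⟩
      ΣV n (λ x → ind (P (false ∷ x)))             ≡⟨ falseHalf ⟩
      N                                            ∎
    eq : count P (allVecs (suc n)) ≡ N * 2
    eq = begin
      count P (allVecs (suc n))      ≡⟨ count≡ΣL P (allVecs (suc n)) ⟩
      ΣL (ind ∘ P) (allVecs (suc n)) ≡⟨ ΣL-allVecs (suc n) (ind ∘ P) ⟩
      ΣV (suc n) (ind ∘ P)           ≡⟨ cong₂ _+_ falseHalf trueHalf ⟩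
      N + N                          ≡⟨ ℕS.solve 1 (λ x → x :+ x := x :* con 2) refl N ⟩
      N * 2                          ∎

  count-Z : odd? n ≡ true → ∀ x → count (λ G → Z {suc n} G ≡ᵇ x) (allGraphs (suc n)) ≡ F n 𝟏 (λ y → ind (y ≡ᵇ x))
  count-Z {n} odd x = begin
    count (λ G → Z {suc n} G ≡ᵇ x) (allGraphs (suc n))
      ≡⟨ count≡ΣL (λ G → Z {suc n} G ≡ᵇ x) (allGraphs (suc n)) ⟩
    ΣL (λ G → h (Z {suc n} G)) (allGraphs (suc n))
      ≡⟨ ΣL-allGraphs (suc n) (λ G → h (Z {suc n} G)) ⟩
    ΣG n (λ G → ΣV n (λ b → h (Z {suc n} (G , b))))
      -- For fixed `G` the diagonal of the Laplacian is a translate of `b`, hence uniform and free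
      -- of `G`.
      ≡⟨ ΣG-cong n (λ G → trans (ΣV-cong (λ b → cong h (Z≡solutions odd (G , b))))
                                (ΣV-shift (adjMul G 𝟏) (λ d → h (solutions (toSym G d) 𝟏)))) ⟩
    ΣG n (λ G → ΣV n (λ d → h (solutions (toSym G d) 𝟏)))
      ≡⟨ ΣG-toSym n (λ S → h (solutions S 𝟏)) ⟩
    F n 𝟏 h ∎
    where h = λ y → ind (y ≡ᵇ x)

open OddPartitions

-- Solving the recursion.

module ClosedForms where

  open import Data.Nat using (_*_)
  open import Data.Nat.Properties using (*-assoc; *-comm; *-identityʳ; *-suc; *-zeroʳ; +-identityʳ; +-suc;
    <⇒≢; ^-monoʳ-<; m≤n+m; m≤n⇒m≤1+n; m≤n⇒m≤o+n; suc-injective; ≡ᵇ⇒≡; ≤-<-trans; ≤-refl)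
  open ℕS using (_:+_; _:*_; _:=_; con)

  δ : ℕ → ℕ → ℕ
  δ x y = ind (y ≡ᵇ x)

  δ-≢ : ∀ {x y} → y ≢ x → δ x y ≡ 0
  δ-≢ {x} {y} y≢x with y ≡ᵇ x in eq
  ... | false = refl
  ... | true  = contradiction (≡ᵇ⇒≡ y x (subst T (sym eq) _)) y≢x

  δ-double : ∀ x y → δ (2 * x) (y + y) ≡ δ x y
  δ-double x y rewrite +-identityʳ x = cong ind (double x y)
    where
    double : ∀ x y → (y + y ≡ᵇ x + x) ≡ (y ≡ᵇ x)
    double zero    zero    = refl
    double zero    (suc y) = refl
    double (suc x) zero    = refl
    double (suc x) (suc y) rewrite +-suc x x | +-suc y y = double x y

  δ-1-double : ∀ y → δ 1 (y + y) ≡ 0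
  δ-1-double zero    = refl
  δ-1-double (suc y) rewrite +-suc y y = refl

  A-cong : ∀ m {f g : ℕ → ℕ} → (∀ x → f x ≡ g x) → A m f ≡ A m g
  A-cong zero          eq = eq 1
  A-cong (suc zero)    eq = cong₂ _+_ (eq 2) (eq 1)
  A-cong (suc (suc m)) eq = cong₂ _+_
    (cong₂ _+_ (A-cong (suc m) (λ x → eq (x + x))) (cong (λ z → e (suc m) * (2 * (2 ^ m * z))) (A-cong m eq)))
    (cong (2 ^ suc m *_) (A-cong (suc m) eq))

  -- The recursion evaluates `h` only at powers of two with exponent at most m: the base cases use 1
  -- and 2, and the term that doubles the argument also lowers the size by one.
  A-vanish : ∀ m h → (∀ j → j ≤ m → h (2 ^ j) ≡ 0) → A m h ≡ 0
  A-vanish zero          h eq = eq 0 z≤n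
  A-vanish (suc zero)    h eq = cong₂ _+_ (eq 1 ≤-refl) (eq 0 z≤n)
  A-vanish (suc (suc m)) h eq = trans
    (cong₂ _+_
      (cong₂ _+_
        (A-vanish (suc m) (λ x → h (x + x))
          (λ j j≤ → trans (cong h (sym (cong (2 ^ j +_) (+-identityʳ (2 ^ j))))) (eq (suc j) (s≤s j≤))))
        (cong (λ z → e (suc m) * (2 * (2 ^ m * z))) (A-vanish m h (λ j j≤ → eq j (m≤n⇒m≤o+n 2 j≤)))))
      (cong (2 ^ suc m *_) (A-vanish (suc m) h (λ j j≤ → eq j (m≤n⇒m≤1+n j≤)))))
    (ℕS.solve 3 (λ x y z → x :* (con 2 :* (y :* con 0)) :+ z :* con 0 := con 0) refl (e (suc m)) (2 ^ m) (2 ^ suc m))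

  B-vanish : ∀ m h → (∀ j → j ≤ m → h (2 ^ j) ≡ 0) → B m h ≡ 0
  B-vanish zero          h eq = refl
  B-vanish (suc zero)    h eq = eq 0 z≤n
  B-vanish (suc (suc m)) h eq = trans
    (cong₂ _+_
      (cong₂ (λ x y → e (suc m) * (2 * (x + e m * y))) (A-vanish m h eq₀) (B-vanish m h eq₀))
      (cong₂ (λ x y → x + e (suc m) * y) (A-vanish (suc m) h eq₁) (B-vanish (suc m) h eq₁)))
    (ℕS.solve 2 (λ x y → x :* (con 2 :* (y :* con 0)) :+ x :* con 0 := con 0) refl (e (suc m)) (e m))
    where
    eq₀ : ∀ j → j ≤ m → h (2 ^ j) ≡ 0
    eq₀ j j≤ = eq j (m≤n⇒m≤o+n 2 j≤)
    eq₁ : ∀ j → j ≤ suc m → h (2 ^ j) ≡ 0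
    eq₁ j j≤ = eq j (m≤n⇒m≤1+n j≤)

  δ-2^-vanish : ∀ m k → m < k → ∀ j → j ≤ m → δ (2 ^ k) (2 ^ j) ≡ 0
  δ-2^-vanish m k m<k j j≤m = δ-≢ {2 ^ k} {2 ^ j} (<⇒≢ (^-monoʳ-< 2 (s≤s (s≤s z≤n)) (≤-<-trans j≤m m<k)))

  -- The products in the closed forms.

  Π : (ℕ → ℕ) → ℕ → ℕ
  Π f zero    = 1
  Π f (suc s) = f 0 * Π (f ∘ suc) s

  Π-snoc : ∀ f s → Π f (suc s) ≡ Π f s * f s
  Π-snoc f zero    = *-comm (f 0) 1
  Π-snoc f (suc s) = trans (cong (f 0 *_) (Π-snoc (f ∘ suc) s)) (sym (*-assoc (f 0) _ _))

  Π-cong : ∀ {f g} s → (∀ i → f i ≡ g i) → Π f s ≡ Π g s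
  Π-cong zero    eq = refl
  Π-cong (suc s) eq = cong₂ _*_ (eq 0) (Π-cong s (eq ∘ suc))

  -- N s / D s = ∏_{i=1}^{s} (1 − 2⁻²ⁱ)⁻¹ and Q k r = ∏_{i=k+1}^{k+r} (2ⁱ − 1).
  D N : ℕ → ℕ
  D = Π (λ i → e (2 * (1 + i)))
  N = Π (λ i → 2 ^ (2 * (1 + i)))

  Q : ℕ → ℕ → ℕ
  Q k = Π (λ i → e (k + 1 + i))

  Q-snoc : ∀ k r → Q k (suc r) ≡ Q k r * e (suc (r + k))
  Q-snoc k r = trans (Π-snoc (λ i → e (k + 1 + i)) r)
    (cong (λ j → Q k r * e j) (ℕS.solve 2 (λ k r → k :+ con 1 :+ r := con 1 :+ (r :+ k)) refl k r))

  Q-cons : ∀ k r → Q k (suc r) ≡ e (suc k) * Q (suc k) r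
  Q-cons k r = cong₂ _*_ (cong e (ℕS.solve 1 (λ k → k :+ con 1 :+ con 0 := con 1 :+ k) refl k))
    (Π-cong r (λ i → cong e (+-suc (k + 1) i)))

  e-+ : ∀ a b → e (a + b) ≡ e b + e a + e b * e a
  e-+ zero    b = ℕS.solve 1 (λ x → x := x :+ con 0 :+ x :* con 0) refl (e b)
  e-+ (suc a) b rewrite e-+ a b = ℕS.solve 2 (λ x y →
    con 1 :+ ((y :+ x :+ y :* x) :+ (y :+ x :+ y :* x)) := y :+ (con 1 :+ (x :+ x)) :+ y :* (con 1 :+ (x :+ x)))
    refl (e a) (e b)

  -- The alternatives are r even and r odd. The second components give the exponent in the factor
  -- that `D` and `N` gain between the indices ⌊r/2⌋ and ⌊r/2⌋ + 1.
  ⌊/2⌋-parity : ∀ r → (⌊ suc r /2⌋ ≡ ⌊ r /2⌋ × 2 * (1 + ⌊ r /2⌋) ≡ 2 + r) ⊎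
                      (⌊ suc r /2⌋ ≡ suc ⌊ r /2⌋ × 2 * (1 + ⌊ r /2⌋) ≡ 1 + r)
  ⌊/2⌋-parity zero          = inj₁ (refl , refl)
  ⌊/2⌋-parity (suc zero)    = inj₂ (refl , refl)
  ⌊/2⌋-parity (suc (suc r)) with ⌊/2⌋-parity r
  ... | inj₁ (p , q) = inj₁ (cong suc p , trans (*-suc 2 (suc ⌊ r /2⌋)) (cong (2 +_) q))
  ... | inj₂ (p , q) = inj₂ (cong suc p , trans (*-suc 2 (suc ⌊ r /2⌋)) (cong (2 +_) q))

  -- In A-even … B-odd: u = e k, v = e r, and M, M₁, M₂ are e (r + k), e (1 + r + k), e (2 + r + k);
  -- the closed forms are cross-multiplied, which makes them semiring identities.
  A-even : ∀ a₀ a₁ a₂ D N q u v {M D₁ N₁ q₁ q₂ P₀ P₁} →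
    let M₁ = suc (M + M) ; M₂ = suc (M₁ + M₁) ; v₁ = suc (v + v) ; y = suc (v₁ + v₁) in
    M ≡ u + v + u * v → P₀ ≡ suc M → P₁ ≡ suc M₁ →
    D₁ ≡ D * y → N₁ ≡ N * suc y → q₁ ≡ q * M₁ → q₂ ≡ q₁ * M₂ →
    a₀ * D ≡ N * q → a₁ * D ≡ N * q₁ → a₂ * D₁ ≡ N₁ * (u * q₁) →
    (a₂ + M₁ * (2 * (P₀ * a₀)) + P₁ * a₁) * D₁ ≡ N₁ * q₂
  A-even a₀ a₁ a₂ D N q u v refl refl refl refl refl refl refl h₀ h₁ h₂ = trans
    (ℕS.solve 7 (λ a₀ a₁ a₂ D y M M₁ →
      (a₂ :+ M₁ :* (con 2 :* ((con 1 :+ M) :* a₀)) :+ (con 1 :+ M₁) :* a₁) :* (D :* y)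
      := a₂ :* (D :* y) :+ (M₁ :* (con 2 :* ((con 1 :+ M) :* y))) :* (a₀ :* D) :+ ((con 1 :+ M₁) :* y) :* (a₁ :* D))
      refl a₀ a₁ a₂ D y M M₁)
    (trans (cong₂ _+_ (cong₂ _+_ h₂ (cong ((M₁ * (2 * (suc M * y))) *_) h₀)) (cong ((suc M₁ * y) *_) h₁))
    (ℕS.solve 4 (λ N q u v →
      let M = u :+ v :+ u :* v ; M₁ = con 1 :+ (M :+ M) ; M₂ = con 1 :+ (M₁ :+ M₁)
          v₁ = con 1 :+ (v :+ v) ; y = con 1 :+ (v₁ :+ v₁) in
      (N :* (con 1 :+ y)) :* (u :* (q :* M₁)) :+ (M₁ :* (con 2 :* ((con 1 :+ M) :* y))) :* (N :* q)
        :+ ((con 1 :+ M₁) :* y) :* (N :* (q :* M₁))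
      := (N :* (con 1 :+ y)) :* ((q :* M₁) :* M₂)) refl N q u v))
    where
    M  = u + v + u * v
    M₁ = suc (M + M)
    y  = suc (suc (v + v) + suc (v + v))

  A-odd : ∀ a₀ a₁ a₂ D N q u v {M D₁ N₁ q₁ q₂ P₀ P₁} →
    let M₁ = suc (M + M) ; M₂ = suc (M₁ + M₁) ; y = suc (v + v) in
    M ≡ u + v + u * v → P₀ ≡ suc M → P₁ ≡ suc M₁ →
    D₁ ≡ D * y → N₁ ≡ N * suc y → q₁ ≡ q * M₁ → q₂ ≡ q₁ * M₂ →
    a₀ * D ≡ N * q → a₁ * D₁ ≡ N₁ * q₁ → a₂ * D₁ ≡ N₁ * (u * q₁) →
    (a₂ + M₁ * (2 * (P₀ * a₀)) + P₁ * a₁) * D₁ ≡ N₁ * q₂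
  A-odd a₀ a₁ a₂ D N q u v refl refl refl refl refl refl refl h₀ h₁ h₂ = trans
    (ℕS.solve 7 (λ a₀ a₁ a₂ D y M M₁ →
      (a₂ :+ M₁ :* (con 2 :* ((con 1 :+ M) :* a₀)) :+ (con 1 :+ M₁) :* a₁) :* (D :* y)
      := a₂ :* (D :* y) :+ (M₁ :* (con 2 :* ((con 1 :+ M) :* y))) :* (a₀ :* D) :+ (con 1 :+ M₁) :* (a₁ :* (D :* y)))
      refl a₀ a₁ a₂ D y M M₁)
    (trans (cong₂ _+_ (cong₂ _+_ h₂ (cong ((M₁ * (2 * (suc M * y))) *_) h₀)) (cong (suc M₁ *_) h₁))
    (ℕS.solve 4 (λ N q u v →
      let M = u :+ v :+ u :* v ; M₁ = con 1 :+ (M :+ M) ; M₂ = con 1 :+ (M₁ :+ M₁) ; y = con 1 :+ (v :+ v) in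
      (N :* (con 1 :+ y)) :* (u :* (q :* M₁)) :+ (M₁ :* (con 2 :* ((con 1 :+ M) :* y))) :* (N :* q)
        :+ (con 1 :+ M₁) :* ((N :* (con 1 :+ y)) :* (q :* M₁))
      := (N :* (con 1 :+ y)) :* ((q :* M₁) :* M₂)) refl N q u v))
    where
    M  = u + v + u * v
    M₁ = suc (M + M)
    y  = suc (v + v)

  B-even : ∀ a₀ a₁ b₀ b₁ D N q M v {D₁ N₁ q₁ q₂} →
    let M₁ = suc (M + M) ; M₂ = suc (M₁ + M₁) ; v₁ = suc (v + v) ; y = suc (v₁ + v₁) in
    D₁ ≡ D * y → N₁ ≡ N * suc y → q₁ ≡ q * M₁ → q₂ ≡ q₁ * M₂ →
    a₀ * D ≡ N * q → a₁ * D ≡ N * q₁ → (M * b₀) * D ≡ v * (N * q) → (M₁ * b₁) * D ≡ v₁ * (N * q₁) →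
    (M₂ * (M₁ * (2 * (a₀ + M * b₀)) + (a₁ + M₁ * b₁))) * D₁ ≡ y * (N₁ * q₂)
  B-even a₀ a₁ b₀ b₁ D N q M v refl refl refl refl h₀ h₁ h₂ h₃ = trans
    (ℕS.solve 8 (λ a₀ a₁ x₀ x₁ D y M₁ M₂ →
      (M₂ :* (M₁ :* (con 2 :* (a₀ :+ x₀)) :+ (a₁ :+ x₁))) :* (D :* y)
      := (M₂ :* y) :* (M₁ :* (con 2 :* (a₀ :* D :+ x₀ :* D)) :+ (a₁ :* D :+ x₁ :* D)))
      refl a₀ a₁ (M * b₀) (M₁ * b₁) D y M₁ M₂)
    (trans (cong ((M₂ * y) *_) (cong₂ _+_ (cong (λ z → M₁ * (2 * z)) (cong₂ _+_ h₀ h₂)) (cong₂ _+_ h₁ h₃)))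
    (ℕS.solve 5 (λ N q v M₁ M₂ →
      let v₁ = con 1 :+ (v :+ v) ; y = con 1 :+ (v₁ :+ v₁) in
      (M₂ :* y) :* (M₁ :* (con 2 :* (N :* q :+ v :* (N :* q))) :+ (N :* (q :* M₁) :+ v₁ :* (N :* (q :* M₁))))
      := y :* ((N :* (con 1 :+ y)) :* ((q :* M₁) :* M₂))) refl N q v M₁ M₂))
    where
    M₁ = suc (M + M)
    M₂ = suc (M₁ + M₁)
    y  = suc (suc (v + v) + suc (v + v))

  B-odd : ∀ a₀ a₁ b₀ b₁ D N q M v {D₁ N₁ q₁ q₂} →
    let M₁ = suc (M + M) ; M₂ = suc (M₁ + M₁) ; y = suc (v + v) in
    D₁ ≡ D * y → N₁ ≡ N * suc y → q₁ ≡ q * M₁ → q₂ ≡ q₁ * M₂ →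
    a₀ * D ≡ N * q → a₁ * D₁ ≡ N₁ * q₁ → (M * b₀) * D ≡ v * (N * q) → (M₁ * b₁) * D₁ ≡ y * (N₁ * q₁) →
    (M₂ * (M₁ * (2 * (a₀ + M * b₀)) + (a₁ + M₁ * b₁))) * D₁ ≡ suc (y + y) * (N₁ * q₂)
  B-odd a₀ a₁ b₀ b₁ D N q M v refl refl refl refl h₀ h₁ h₂ h₃ = trans
    (ℕS.solve 8 (λ a₀ a₁ x₀ x₁ D y M₁ M₂ →
      (M₂ :* (M₁ :* (con 2 :* (a₀ :+ x₀)) :+ (a₁ :+ x₁))) :* (D :* y)
      := M₂ :* ((y :* M₁) :* (con 2 :* (a₀ :* D :+ x₀ :* D)) :+ (a₁ :* (D :* y) :+ x₁ :* (D :* y))))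
      refl a₀ a₁ (M * b₀) (M₁ * b₁) D y M₁ M₂)
    (trans (cong (M₂ *_) (cong₂ _+_ (cong (λ z → (y * M₁) * (2 * z)) (cong₂ _+_ h₀ h₂)) (cong₂ _+_ h₁ h₃)))
    (ℕS.solve 5 (λ N q v M₁ M₂ →
      let y = con 1 :+ (v :+ v) in
      M₂ :* ((y :* M₁) :* (con 2 :* (N :* q :+ v :* (N :* q)))
        :+ ((N :* (con 1 :+ y)) :* (q :* M₁) :+ y :* ((N :* (con 1 :+ y)) :* (q :* M₁))))
      := (con 1 :+ (y :+ y)) :* ((N :* (con 1 :+ y)) :* ((q :* M₁) :* M₂))) refl N q v M₁ M₂))
    where
    M₁ = suc (M + M)
    M₂ = suc (M₁ + M₁)
    y  = suc (v + v)

  -- Closed forms for the two sequences.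

  α β : ℕ → ℕ → ℕ
  α m k = A m (δ (2 ^ k))
  β m k = B m (δ (2 ^ k))

  -- Cross-multiplied forms, with r = m - k: α m k is (`N` / `D`) at ⌊r/2⌋ times `Q k r`, and for m
  -- > 0 β m k is (2ʳ - 1)/(2ᵐ - 1) times α m k.
  αClosed βClosed : ℕ → ℕ → ℕ → Set
  αClosed m k r = α m k * D ⌊ r /2⌋ ≡ N ⌊ r /2⌋ * Q k r
  βClosed m k r = (e m * β m k) * D ⌊ r /2⌋ ≡ e r * (N ⌊ r /2⌋ * Q k r)

  Closed : ℕ → Set
  Closed m = ∀ k r → m ≡ r + k → αClosed m k r × βClosed m k r

  α-vanish : ∀ m k → m < k → α m k ≡ 0
  α-vanish m k m<k = A-vanish m (δ (2 ^ k)) (δ-2^-vanish m k m<k)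

  β-vanish : ∀ m k → m < k → β m k ≡ 0
  β-vanish m k m<k = B-vanish m (δ (2 ^ k)) (δ-2^-vanish m k m<k)

  -- The contribution of a zero first row, which doubles the number of solutions.
  α′ : ℕ → ℕ → ℕ
  α′ m k = A m (λ x → δ (2 ^ k) (x + x))

  α′-suc : ∀ m k → α′ m (suc k) ≡ α m k
  α′-suc m k = A-cong m (δ-double (2 ^ k))

  α′-zero : ∀ m → α′ m 0 ≡ 0
  α′-zero m = A-vanish m (λ x → δ 1 (x + x)) (λ j _ → δ-1-double (2 ^ j))

  D-suc : ∀ s → D (suc s) ≡ D s * e (2 * (1 + s))
  D-suc = Π-snoc (λ i → e (2 * (1 + i)))

  N-suc : ∀ s → N (suc s) ≡ N s * suc (e (2 * (1 + s)))
  N-suc s = trans (Π-snoc (λ i → 2 ^ (2 * (1 + i))) s) (cong (N s *_) (2^≡1+e (2 * (1 + s))))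

  -- For k > 0 this is the closed form at k - 1, whose product has the extra leading factor `e k`.
  -- For k = 0 both sides vanish: doubling never gives 1, and `e 0` is 0.
  α′Closed : ∀ m k r → Closed (suc m) → suc (suc m) ≡ suc r + k →
    α′ (suc m) k * D ⌊ suc r /2⌋ ≡ N ⌊ suc r /2⌋ * (e k * Q k r)
  α′Closed m zero    r cl eq rewrite α′-zero (suc m) = sym (*-zeroʳ (N ⌊ suc r /2⌋))
  α′Closed m (suc k) r cl eq = begin
    α′ (suc m) (suc k) * D ⌊ suc r /2⌋         ≡⟨ cong (_* D ⌊ suc r /2⌋) (α′-suc (suc m) k) ⟩
    α (suc m) k * D ⌊ suc r /2⌋                ≡⟨ proj₁ (cl k (suc r) (suc-injective (trans eq (cong suc (+-suc r k))))) ⟩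
    N ⌊ suc r /2⌋ * Q k (suc r)                ≡⟨ cong (N ⌊ suc r /2⌋ *_) (Q-cons k r) ⟩
    N ⌊ suc r /2⌋ * (e (suc k) * Q (suc k) r)  ∎

  -- For r ≥ 2 every term of the recursion has its own closed form. For r = 0 and r = 1 some terms
  -- have k above their size and vanish, so these cases are separate.
  closed-step : ∀ m → Closed m → Closed (suc m) → Closed (suc (suc m))
  closed-step m cl₀ cl₁ (suc (suc k)) zero refl
    rewrite α′-suc (suc k) (suc k) | α-vanish k (2 + k) (m≤n+m (1 + k) 1) | α-vanish (suc k) (2 + k) ≤-refl
          | β-vanish k (2 + k) (m≤n+m (1 + k) 1) | β-vanish (suc k) (2 + k) ≤-refl
    = (trans (ℕS.solve 4 (λ a x y z → (a :+ x :* (con 2 :* (y :* con 0)) :+ z :* con 0) :* con 1 := a :* con 1) refl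
         (α (suc k) (suc k)) (e (suc k)) (2 ^ k) (2 ^ suc k)) (proj₁ (cl₁ (suc k) 0 refl)))
    , ℕS.solve 3 (λ x y z → (x :* (y :* (con 2 :* (z :* con 0)) :+ y :* con 0)) :* con 1 := con 0)
        refl (e (2 + k)) (e (suc k)) (e k)
  closed-step m cl₀ cl₁ (suc k) (suc zero) refl
    = α-closed , β-closed
    where
    a₁ : α (suc k) (suc k) ≡ 1
    a₁ = trans (sym (*-identityʳ _)) (proj₁ (cl₁ (suc k) 0 refl))
    b₁ : e (suc k) * β (suc k) (suc k) ≡ 0
    b₁ = trans (sym (*-identityʳ _)) (proj₂ (cl₁ (suc k) 0 refl))
    a₀ : α k (suc k) ≡ 0
    a₀ = α-vanish k (suc k) ≤-refl
    b₀ : β k (suc k) ≡ 0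
    b₀ = β-vanish k (suc k) ≤-refl
    a₂ : α′ (suc k) (suc k) * 1 ≡ 1 * (e (suc k) * 1)
    a₂ = α′Closed k (suc k) 0 cl₁ refl
    α-closed : αClosed (suc (suc k)) (suc k) 1
    α-closed = begin
      (α′ (suc k) (suc k) + e (suc k) * (2 * (2 ^ k * α k (suc k))) + 2 ^ suc k * α (suc k) (suc k)) * 1
        ≡⟨ cong (_* 1) (cong₂ (λ x y → α′ (suc k) (suc k) + e (suc k) * (2 * (2 ^ k * x)) + 2 ^ suc k * y) a₀ a₁) ⟩
      (α′ (suc k) (suc k) + e (suc k) * (2 * (2 ^ k * 0)) + 2 ^ suc k * 1) * 1
        ≡⟨ ℕS.solve 4 (λ a x y z → (a :+ x :* (con 2 :* (y :* con 0)) :+ z :* con 1) :* con 1 := a :* con 1 :+ z) refl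
             (α′ (suc k) (suc k)) (e (suc k)) (2 ^ k) (2 ^ suc k) ⟩
      α′ (suc k) (suc k) * 1 + 2 ^ suc k
        ≡⟨ cong₂ _+_ a₂ (2^≡1+e (suc k)) ⟩
      1 * (e (suc k) * 1) + suc (e (suc k))
        ≡⟨ ℕS.solve 1 (λ x → con 1 :* (x :* con 1) :+ (con 1 :+ x) := con 1 :* (con 1 :* (con 1 :+ (x :+ x))))
             refl (e (suc k)) ⟩
      1 * (1 * e (suc (suc k)))
        ≡⟨ cong (1 *_) (sym (Q-snoc (suc k) 0)) ⟩
      1 * Q (suc k) 1 ∎
    β-closed : βClosed (suc (suc k)) (suc k) 1
    β-closed = begin
      (e (suc (suc k)) * (e (suc k) * (2 * (α k (suc k) + e k * β k (suc k)))
        + (α (suc k) (suc k) + e (suc k) * β (suc k) (suc k)))) * 1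
        ≡⟨ cong (λ z → e (suc (suc k)) * z * 1)
             (cong₂ _+_ (cong₂ (λ x y → e (suc k) * (2 * (x + e k * y))) a₀ b₀) (cong₂ _+_ a₁ b₁)) ⟩
      (e (suc (suc k)) * (e (suc k) * (2 * (e k * 0)) + 1)) * 1
        ≡⟨ ℕS.solve 3 (λ x y z → (x :* (y :* (con 2 :* (z :* con 0)) :+ con 1)) :* con 1 := con 1 :* (con 1 :* (con 1 :* x)))
             refl (e (suc (suc k))) (e (suc k)) (e k) ⟩
      1 * (1 * (1 * e (suc (suc k))))
        ≡⟨ cong (λ z → 1 * (1 * z)) (sym (Q-snoc (suc k) 0)) ⟩
      1 * (1 * Q (suc k) 1) ∎
  closed-step m cl₀ cl₁ k (suc (suc r)) refl = cases (⌊/2⌋-parity r)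
    where
    s = ⌊ r /2⌋
    e-sum : e (r + k) ≡ e k + e r + e k * e r
    e-sum = e-+ r k
    D-eq : ∀ {j} → 2 * (1 + s) ≡ j → D (suc s) ≡ D s * e j
    D-eq len = trans (D-suc s) (cong (λ j → D s * e j) len)
    N-eq : ∀ {j} → 2 * (1 + s) ≡ j → N (suc s) ≡ N s * suc (e j)
    N-eq len = trans (N-suc s) (cong (λ j → N s * suc (e j)) len)
    h₁ : ∀ {t} → ⌊ suc r /2⌋ ≡ t → α (suc (r + k)) k * D t ≡ N t * Q k (suc r)
    h₁ refl = proj₁ (cl₁ k (suc r) refl)
    h₃ : ∀ {t} → ⌊ suc r /2⌋ ≡ t → (e (suc (r + k)) * β (suc (r + k)) k) * D t ≡ e (suc r) * (N t * Q k (suc r))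
    h₃ refl = proj₂ (cl₁ k (suc r) refl)
    h₀ = proj₁ (cl₀ k r refl)
    h₂ = proj₂ (cl₀ k r refl)
    a₀ = α (r + k) k
    a₁ = α (suc (r + k)) k
    a₂ = α′ (suc (r + k)) k
    b₀ = β (r + k) k
    b₁ = β (suc (r + k)) k
    cases : (⌊ suc r /2⌋ ≡ s × 2 * (1 + s) ≡ 2 + r) ⊎ (⌊ suc r /2⌋ ≡ suc s × 2 * (1 + s) ≡ 1 + r) →
            αClosed (2 + (r + k)) k (2 + r) × βClosed (2 + (r + k)) k (2 + r)
    cases (inj₁ (half , len)) =
        A-even a₀ a₁ a₂ (D s) (N s) (Q k r) (e k) (e r) e-sum (2^≡1+e (r + k)) (2^≡1+e (suc (r + k)))
          (D-eq len) (N-eq len) (Q-snoc k r) (Q-snoc k (suc r)) h₀ (h₁ half) (α′Closed m k (suc r) cl₁ refl)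
      , B-even a₀ a₁ b₀ b₁ (D s) (N s) (Q k r) (e (r + k)) (e r)
          (D-eq len) (N-eq len) (Q-snoc k r) (Q-snoc k (suc r)) h₀ (h₁ half) h₂ (h₃ half)
    cases (inj₂ (half , len)) =
        A-odd a₀ a₁ a₂ (D s) (N s) (Q k r) (e k) (e r) e-sum (2^≡1+e (r + k)) (2^≡1+e (suc (r + k)))
          (D-eq len) (N-eq len) (Q-snoc k r) (Q-snoc k (suc r)) h₀ (h₁ half) (α′Closed m k (suc r) cl₁ refl)
      , B-odd a₀ a₁ b₀ b₁ (D s) (N s) (Q k r) (e (r + k)) (e r)
          (D-eq len) (N-eq len) (Q-snoc k r) (Q-snoc k (suc r)) h₀ (h₁ half) h₂ (h₃ half)

  closed : ∀ m → Closed m × Closed (suc m)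
  closed zero = closed₀ , closed₁
    where
    closed₀ : Closed 0
    closed₀ k zero    refl = refl , refl
    closed₀ k (suc r) ()
    closed₁ : Closed 1
    closed₁ k       zero          refl = refl , refl
    closed₁ zero    (suc zero)    refl = refl , refl
    closed₁ (suc k) (suc zero)    ()
    closed₁ k       (suc (suc r)) ()
  closed (suc m) = proj₂ (closed m) , closed-step m (proj₁ (closed m)) (proj₂ (closed m))

open ClosedForms

-- Passage from natural numbers to rationals.

open import Data.Integer as ℤ using (+_)
import Data.Integer.Properties as ℤ
open import Data.Rational as ℚ using (ℚ; mkℚ; _*_; _-_; 0ℚ; 1ℚ; ≢-nonZero)
import Data.Rational.Properties as ℚ
open import Data.Rational.Solver using () renaming (module +-*-Solver to ℚS)
open ℚS using (_:+_; _:-_; _:*_; _:=_; con)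

ℕtoℚ≡mkℚ : ∀ m → ℕtoℚ m ≡ mkℚ (+ m) 0 (coprime-sym (1-coprimeTo m))
ℕtoℚ≡mkℚ m = ℚ.normalize-coprime (coprime-sym (1-coprimeTo m))

ℕtoℚ-+ : ∀ m n → ℕtoℚ (m + n) ≡ ℕtoℚ m ℚ.+ ℕtoℚ n
ℕtoℚ-+ m n = sym (trans (cong₂ ℚ._+_ (ℕtoℚ≡mkℚ m) (ℕtoℚ≡mkℚ n))
  (cong (ℚ._/ 1) (cong₂ ℤ._+_ (ℤ.*-identityʳ (+ m)) (ℤ.*-identityʳ (+ n)))))

ℕtoℚ-* : ∀ m n → ℕtoℚ (m ℕ.* n) ≡ ℕtoℚ m * ℕtoℚ n
ℕtoℚ-* m n = sym (trans (cong₂ _*_ (ℕtoℚ≡mkℚ m) (ℕtoℚ≡mkℚ n))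
  (cong (ℚ._/ 1) (sym (ℤ.pos-* m n))))

ℕtoℚ-≢0 : ∀ {n} → n ≢ 0 → ℕtoℚ n ≢ 0ℚ
ℕtoℚ-≢0 {zero}  n≢0 _  = n≢0 refl
ℕtoℚ-≢0 {suc n} _   eq with trans (sym (ℕtoℚ≡mkℚ (suc n))) eq
... | ()

ℕtoℚ-2^∸1 : ∀ i → ℕtoℚ (2 ^ i) - 1ℚ ≡ ℕtoℚ (e i)
ℕtoℚ-2^∸1 i = trans (cong (_- 1ℚ) (trans (cong ℕtoℚ (2^≡1+e i)) (ℕtoℚ-+ 1 (e i))))
  (ℚS.solve 1 (λ x → (con 1ℚ :+ x) :- con 1ℚ := x) refl (ℕtoℚ (e i)))

2^≢0 : ∀ i → 2 ^ i ≢ 0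
2^≢0 i eq with trans (sym (2^≡1+e i)) eq
... | ()

inv-*ˡ : ∀ {p} → p ≢ 0ℚ → inv p * p ≡ 1ℚ
inv-*ˡ {p} p≢0 with p ℚ.≟ 0ℚ
... | yes p≡0 = contradiction p≡0 p≢0
... | no  p≢0 = ℚ.*-inverseˡ p {{≢-nonZero p≢0}}

Πℚ : (ℕ → ℚ) → ℕ → ℚ
Πℚ f s = foldr _*_ 1ℚ (applyUpTo f s)

Πℚ-ℕtoℚ : ∀ f g s → (∀ i → f i ≡ ℕtoℚ (g i)) → Πℚ f s ≡ ℕtoℚ (Π g s)
Πℚ-ℕtoℚ f g zero    eq = refl
Πℚ-ℕtoℚ f g (suc s) eq = trans (cong₂ _*_ (eq 0) (Πℚ-ℕtoℚ (f ∘ suc) (g ∘ suc) s (eq ∘ suc)))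
  (sym (ℕtoℚ-* (g 0) (Π (g ∘ suc) s)))

Πℚ-fraction : ∀ f d n s → (∀ i → f i * ℕtoℚ (d i) ≡ ℕtoℚ (n i)) → Πℚ f s * ℕtoℚ (Π d s) ≡ ℕtoℚ (Π n s)
Πℚ-fraction f d n zero    eq = refl
Πℚ-fraction f d n (suc s) eq = begin
  (f 0 * Πℚ f′ s) * ℕtoℚ (d 0 ℕ.* Π d′ s)           ≡⟨ cong ((f 0 * Πℚ f′ s) *_) (ℕtoℚ-* (d 0) (Π d′ s)) ⟩
  (f 0 * Πℚ f′ s) * (ℕtoℚ (d 0) * ℕtoℚ (Π d′ s))
    ≡⟨ ℚS.solve 4 (λ a b c d → (a :* b) :* (c :* d) := (a :* c) :* (b :* d))
         refl (f 0) (Πℚ f′ s) (ℕtoℚ (d 0)) (ℕtoℚ (Π d′ s)) ⟩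
  (f 0 * ℕtoℚ (d 0)) * (Πℚ f′ s * ℕtoℚ (Π d′ s))    ≡⟨ cong₂ _*_ (eq 0) (Πℚ-fraction f′ d′ (n ∘ suc) s (eq ∘ suc)) ⟩
  ℕtoℚ (n 0) * ℕtoℚ (Π (n ∘ suc) s)                 ≡⟨ sym (ℕtoℚ-* (n 0) (Π (n ∘ suc) s)) ⟩
  ℕtoℚ (Π n (suc s)) ∎
  where
  f′ = f ∘ suc
  d′ = d ∘ suc

-- The exponent is positive, which keeps 1 - 2⁻ʲ away from 0, where `inv` takes its default value.
inv[1-2⁻ʲ] : ∀ j → inv (1ℚ - inv (ℕtoℚ (2 ^ suc j))) * ℕtoℚ (e (suc j)) ≡ ℕtoℚ (2 ^ suc j)
inv[1-2⁻ʲ] j = begin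
  inv z * ℕtoℚ (e (suc j))  ≡⟨ cong (inv z *_) (sym zy) ⟩
  inv z * (z * y)           ≡⟨ sym (ℚ.*-assoc (inv z) z y) ⟩
  (inv z * z) * y           ≡⟨ cong (_* y) (inv-*ˡ z≢0) ⟩
  1ℚ * y                    ≡⟨ ℚ.*-identityˡ y ⟩
  y                         ∎
  where
  y = ℕtoℚ (2 ^ suc j)
  z = 1ℚ - inv y
  zy : z * y ≡ ℕtoℚ (e (suc j))
  zy = begin
    (1ℚ - inv y) * y  ≡⟨ ℚS.solve 2 (λ y i → (con 1ℚ :- i) :* y := y :- i :* y) refl y (inv y) ⟩
    y - inv y * y     ≡⟨ cong (λ t → y - t) (inv-*ˡ (ℕtoℚ-≢0 (2^≢0 (suc j)))) ⟩
    y - 1ℚ            ≡⟨ ℕtoℚ-2^∸1 (suc j) ⟩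
    ℕtoℚ (e (suc j))  ∎
  z≢0 : z ≢ 0ℚ
  z≢0 z≡0 = ℕtoℚ-≢0 {e (suc j)} (λ ()) (trans (sym zy) (trans (cong (_* y) z≡0) (ℚ.*-zeroˡ y)))

Π-≢0 : ∀ f s → (∀ i → f i ≢ 0) → Π f s ≢ 0
Π-≢0 f zero    f≢0 ()
Π-≢0 f (suc s) f≢0 eq = [ f≢0 0 , Π-≢0 (f ∘ suc) s (f≢0 ∘ suc) ]′ (ℕ.m*n≡0⇒m≡0∨n≡0 (f 0) eq)

n/2≡⌊n/2⌋ : ∀ n → n / 2 ≡ ⌊ n /2⌋
n/2≡⌊n/2⌋ zero          = refl
n/2≡⌊n/2⌋ (suc zero)    = refl
n/2≡⌊n/2⌋ (suc (suc n)) = trans (m/n≡1+[m∸n]/n {suc (suc n)} {2} (s≤s (s≤s z≤n))) (cong suc (n/2≡⌊n/2⌋ n))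

-- Turns the cross-multiplied `βClosed` into the stated quotient: `b` is the number of graphs, `c`
-- the number of all graphs, `Em` and `Er` are 2ᵐ - 1 and 2ʳ - 1, `P` is the product of inverses,
-- equal to n / d, and `q` is the integer product.
cancel-denominators : ∀ b c Er Em P d q {n} → c ≢ 0ℚ → c * Em ≢ 0ℚ → d ≢ 0ℚ →
  P * d ≡ n → (Em * b) * d ≡ Er * (n * q) →
  b * inv c ≡ ((Er * inv (c * Em)) * P) * q
cancel-denominators b c Er Em P d q {n} c≢0 cEm≢0 d≢0 Pd≡n eq = begin
  b * inv c
    ≡⟨ sym (ℚ.*-identityʳ (b * inv c)) ⟩
  (b * inv c) * 1ℚ
    ≡⟨ cong ((b * inv c) *_) (sym (inv-*ˡ cEm≢0)) ⟩
  (b * inv c) * (i * (c * Em))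
    ≡⟨ ℚS.solve 5 (λ b j i c E → (b :* j) :* (i :* (c :* E)) := (j :* c) :* (i :* (E :* b))) refl b (inv c) i c Em ⟩
  (inv c * c) * (i * (Em * b))
    ≡⟨ cong₂ (λ x y → x * (i * y)) (inv-*ˡ c≢0) Emb ⟩
  1ℚ * (i * (Er * (P * q)))
    ≡⟨ ℚS.solve 4 (λ i E P q → con 1ℚ :* (i :* (E :* (P :* q))) := ((E :* i) :* P) :* q) refl i Er P q ⟩
  ((Er * i) * P) * q ∎
  where
  i = inv (c * Em)
  Emb : Em * b ≡ Er * (P * q)
  Emb = begin
    Em * b                            ≡⟨ sym (ℚ.*-identityʳ (Em * b)) ⟩
    (Em * b) * 1ℚ                     ≡⟨ cong ((Em * b) *_) (sym (inv-*ˡ d≢0)) ⟩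
    (Em * b) * (inv d * d)            ≡⟨ ℚS.solve 3 (λ x w d → x :* (w :* d) := w :* (x :* d)) refl (Em * b) (inv d) d ⟩
    inv d * ((Em * b) * d)            ≡⟨ cong (inv d *_) eq ⟩
    inv d * (Er * (n * q))            ≡⟨ cong (λ t → inv d * (Er * (t * q))) (sym Pd≡n) ⟩
    inv d * (Er * ((P * d) * q))
      ≡⟨ ℚS.solve 5 (λ w E P d q → w :* (E :* ((P :* d) :* q)) := (w :* d) :* (E :* (P :* q)))
           refl (inv d) Er P d q ⟩
    (inv d * d) * (Er * (P * q))      ≡⟨ cong (_* (Er * (P * q))) (inv-*ˡ d≢0) ⟩
    1ℚ * (Er * (P * q))               ≡⟨ ℚ.*-identityˡ _ ⟩
    Er * (P * q)                      ∎

-- From counts of graphs to probabilities.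

odd?-pred : ∀ m → 2 ∣ suc m → odd? m ≡ true
odd?-pred m (divides q eq) = not-injective (trans (sym (odd?-suc m)) (trans (cong odd? eq) (odd?-*2 q)))
  where
  odd?-*2 : ∀ q → odd? (q ℕ.* 2) ≡ false
  odd?-*2 zero    = refl
  odd?-*2 (suc q) = odd?-*2 q

-- An odd m is positive, so the right-hand side 𝟏 is nonzero and the relevant sequence is `B`; x ≠ 0
-- makes the indicator vanish at 0.
count-Z≡B : ∀ m → odd? m ≡ true → ∀ x → x ≢ 0 →
  count (λ G → Z {suc m} G ℕ.≡ᵇ x) (allGraphs (suc m)) ≡ B m (δ x)
count-Z≡B (suc m) odd x x≢0 = trans (count-Z {suc m} odd x)
  (proj₂ (proj₁ (F-spec (suc m)) (δ x) (δ-≢ {x} {0} (x≢0 ∘ sym))) 𝟏 refl)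

ProbZ-2^ : ∀ m → odd? m ≡ true → ∀ k r → m ≡ r + k →
  ProbZ≡ (suc m) (2 ^ k) ≡
    ((ℕtoℚ (e r) * inv (ℕtoℚ (2 ^ (suc m C 2)) * ℕtoℚ (e m)))
      * Πℚ (λ i → inv (1ℚ - inv (ℕtoℚ (2 ^ (2 ℕ.* (1 + i)))))) ⌊ r /2⌋)
      * ℕtoℚ (Q k r)
ProbZ-2^ m@(suc m₀) odd k r m≡r+k = begin
  ℕtoℚ (count (λ G → Z {suc m} G ℕ.≡ᵇ 2 ^ k) (allGraphs (suc m))) * inv c
    ≡⟨ cong (λ b → ℕtoℚ b * inv c) (count-Z≡B m odd (2 ^ k) (2^≢0 k)) ⟩
  ℕtoℚ (β m k) * inv c
    ≡⟨ cancel-denominators (ℕtoℚ (β m k)) c (ℕtoℚ (e r)) (ℕtoℚ (e m)) (Πℚ f s) (ℕtoℚ (D s)) (ℕtoℚ (Q k r))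
         c≢0 cEm≢0 D≢0 fraction scaled ⟩
  ((ℕtoℚ (e r) * inv (c * ℕtoℚ (e m))) * Πℚ f s) * ℕtoℚ (Q k r) ∎
  where
  s = ⌊ r /2⌋
  c = ℕtoℚ (2 ^ (suc m C 2))
  f = λ i → inv (1ℚ - inv (ℕtoℚ (2 ^ (2 ℕ.* (1 + i)))))
  c≢0 : c ≢ 0ℚ
  c≢0 = ℕtoℚ-≢0 (2^≢0 (suc m C 2))
  cEm≢0 : c * ℕtoℚ (e m) ≢ 0ℚ
  cEm≢0 eq = ℕtoℚ-≢0 (λ z → [ 2^≢0 (suc m C 2) , (λ ()) ]′ (ℕ.m*n≡0⇒m≡0∨n≡0 (2 ^ (suc m C 2)) z))
    (trans (ℕtoℚ-* (2 ^ (suc m C 2)) (e m)) eq)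
  D≢0 : ℕtoℚ (D s) ≢ 0ℚ
  D≢0 = ℕtoℚ-≢0 (Π-≢0 (λ i → e (2 ℕ.* (1 + i))) s (λ i ()))
  fraction : Πℚ f s * ℕtoℚ (D s) ≡ ℕtoℚ (N s)
  -- The exponent 2 (1 + i) reduces to the successor of `i + suc (i + 0)`.
  fraction = Πℚ-fraction f (λ i → e (2 ℕ.* (1 + i))) (λ i → 2 ^ (2 ℕ.* (1 + i))) s (λ i → inv[1-2⁻ʲ] (i + suc (i + 0)))
  scaled : (ℕtoℚ (e m) * ℕtoℚ (β m k)) * ℕtoℚ (D s) ≡ ℕtoℚ (e r) * (ℕtoℚ (N s) * ℕtoℚ (Q k r))
  scaled = begin
    (ℕtoℚ (e m) * ℕtoℚ (β m k)) * ℕtoℚ (D s)  ≡⟨ cong (_* ℕtoℚ (D s)) (sym (ℕtoℚ-* (e m) (β m k))) ⟩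
    ℕtoℚ (e m ℕ.* β m k) * ℕtoℚ (D s)         ≡⟨ sym (ℕtoℚ-* (e m ℕ.* β m k) (D s)) ⟩
    ℕtoℚ (e m ℕ.* β m k ℕ.* D s)              ≡⟨ cong ℕtoℚ (proj₂ (proj₁ (closed m) k r m≡r+k)) ⟩
    ℕtoℚ (e r ℕ.* (N s ℕ.* Q k r))            ≡⟨ ℕtoℚ-* (e r) (N s ℕ.* Q k r) ⟩
    ℕtoℚ (e r) * ℕtoℚ (N s ℕ.* Q k r)         ≡⟨ cong (ℕtoℚ (e r) *_) (ℕtoℚ-* (N s) (Q k r)) ⟩
    ℕtoℚ (e r) * (ℕtoℚ (N s) * ℕtoℚ (Q k r))  ∎

theorem5p5 : (n : ℕ) → 2 ∣ n → 0 < n →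
    ((k : ℕ) → k ≤ n ∸ 1 →
    ProbZ≡ n (2 ^ k)
    ≡ ((ℕtoℚ (2 ^ (n ∸ k ∸ 1)) - 1ℚ)
    * inv (ℕtoℚ (2 ^ (n C 2)) * (ℕtoℚ (2 ^ (n ∸ 1)) - 1ℚ)))
    * prodFromTo 1 ((n ∸ 1 ∸ k) / 2)
    (λ i → inv (1ℚ - inv (ℕtoℚ (2 ^ (2 ℕ.* i)))))
    * prodFromTo (k + 1) (n ∸ 1) (λ i → ℕtoℚ (2 ^ i) - 1ℚ))
    × ((x : ℕ) → x ≢ 0 → ((k : ℕ) → k ≤ n ∸ 1 → x ≢ 2 ^ k) → ProbZ≡ n x ≡ 0ℚ)
theorem5p5 (suc m) 2∣n _ = powers , others
  where
  odd = odd?-pred m 2∣n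
  f = λ i → inv (1ℚ - inv (ℕtoℚ (2 ^ (2 ℕ.* (1 + i)))))
  g = λ i → ℕtoℚ (2 ^ i) - 1ℚ
  powers : ∀ k → k ≤ m → ProbZ≡ (suc m) (2 ^ k)
    ≡ ((ℕtoℚ (2 ^ (suc m ∸ k ∸ 1)) - 1ℚ) * inv (ℕtoℚ (2 ^ (suc m C 2)) * (ℕtoℚ (2 ^ m) - 1ℚ)))
      * Πℚ f ((m ∸ k) / 2) * Πℚ (λ i → g (k + 1 + i)) (suc m ∸ (k + 1))
  -- `prodFromTo` unfolds to products with indices 1 + i and k + 1 + i. The length of the second one
  -- and the exponent suc m ∸ k ∸ 1 become r once k + 1 is rewritten as suc k.
  powers k k≤m = trans (ProbZ-2^ m odd k r (sym (ℕ.m∸n+n≡m k≤m))) (sym (cong₂ _*_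
    (cong₂ _*_
      (cong₂ (λ x y → x * inv (ℕtoℚ (2 ^ (suc m C 2)) * y))
        (trans (cong (λ j → ℕtoℚ (2 ^ j) - 1ℚ) exponent) (ℕtoℚ-2^∸1 r)) (ℕtoℚ-2^∸1 m))
      (cong (Πℚ f) (n/2≡⌊n/2⌋ r)))
    (trans (cong (Πℚ (λ i → g (k + 1 + i))) (cong (suc m ∸_) (ℕ.+-comm k 1)))
           (Πℚ-ℕtoℚ (λ i → g (k + 1 + i)) (λ i → e (k + 1 + i)) r (λ i → ℕtoℚ-2^∸1 (k + 1 + i))))))
    where
    r = m ∸ k
    exponent : suc m ∸ k ∸ 1 ≡ r
    exponent = trans (ℕ.∸-+-assoc (suc m) k 1) (cong (suc m ∸_) (ℕ.+-comm k 1))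
  others : ∀ x → x ≢ 0 → (∀ k → k ≤ m → x ≢ 2 ^ k) → ProbZ≡ (suc m) x ≡ 0ℚ
  -- `B m` sees only the values 2ʲ with j ≤ m, and the indicator of x is 0 at all of them.
  others x x≢0 x≢2^ = trans
    (cong (λ b → ℕtoℚ b * inv (ℕtoℚ (2 ^ (suc m C 2))))
      (trans (count-Z≡B m odd x x≢0) (B-vanish m (δ x) (λ j j≤m → δ-≢ {x} {2 ^ j} (x≢2^ j j≤m ∘ sym)))))
    (ℚ.*-zeroˡ (inv (ℕtoℚ (2 ^ (suc m C 2)))))
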